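{- In the secretary setting of online pen testing, any algorithm is at best $\Omega(\log n)$-competitive in each of the following two cases: (1) the order is random and the player is given optimum information; (2) the order is arbitrary and the player is given full information. That is, there is a universal constant $c>0$ such that, for all sufficiently large $n$, in each of the two cases, every $\alpha$ for which an $\alpha$-competitive player exists satisfies $\alpha\ge c\log n$.
   Context: Online pen testing: an instance is given by values $X_1,\ldots,X_n \ge 0$, hidden from the player. At each step $i=1,2,\ldots,n$ in order, the player first picks a threshold $\theta_i \in [0,+\infty]$. If $X_i > \theta_i$ the test passes (and the player learns only that it passed); if $X_i \le \theta_i$ the test fails and the player observes $X_i$. The remaining utility of option $i$ becomes $X_i' = \max\{X_i-\theta_i,0\}$ (which is $0$ if $\theta_i=+\infty$). The player then irrevocably accepts or rejects option $i$; upon acceptance the game ends with score $X_i'$. If no option is ever accepted the score is $0$. The player knows $n$ and may be randomized: $\theta_i$ may depend on the information given in advance, on the outcomes of the previous tests and on internal randomness (independent of the arrival order), and the accept/reject decision may in addition depend on the outcome of test $i$. Secretary setting: there are numbers $a_1,\ldots,a_n\ge 0$, and $(X_1,\ldots,X_n)$ is a permutation of $(a_1,\ldots,a_n)$. In the random order case the permutation is uniformly random; in the arbitrary order case it is an arbitrary fixed permutation, unknown to the player. The information given to the player in advance is one of: full information (the player is given $a_1,\ldots,a_n$); optimum information (the player is given only $\max_i a_i$); no information (the player is given nothing about the $a_i$'s). A player (a fixed strategy taking the given information as input) is $\alpha$-competitive in the random order case if for all $a_1,\ldots,a_n\ge0$ its expected score, over the permutation and its own randomness, is at least $\frac1\alpha\max_i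 a_i$. It is $\alpha$-competitive in the arbitrary order case if for all $a_1,\ldots,a_n\ge0$ and every permutation $(X_i)$ of $(a_i)$ its expected score, over its own randomness, is at least $\frac1\alpha\max_i a_i$. -}

module Defs where

open import Algebra.Bundles using (CommutativeRing)
import Algebra.Construct.NaturalChoice.Max as NaturalMax
import Algebra.Properties.Semiring.Mult as Mult
import Algebra.Properties.Ring as RingProperties
open import Algebra.Structures using (IsCommutativeRing)
open import Data.Bool.Base using (Bool; true; false; if_then_else_; not; _∧_)
open import Data.Fin.Base using (Fin; zero; suc; punchIn)
open import Data.Fin.Permutation as Perm using (Permutation′; _⟨$⟩ʳ_)
open import Data.List.Base as List using (List; []; _∷_; allFin; cartesianProductWith; length)
import Data.List.Properties as List
open import Data.List.Membership.Propositional.Properties using (∈-allFin)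
open import Data.List.Relation.Unary.Any using (Any; here)
import Data.List.Relation.Unary.Any.Properties as Any
open import Data.Nat.Base as ℕ using (ℕ; zero; suc; NonZero; _!; z≤n; s≤s)
import Data.Nat.Properties as ℕ
open import Data.Product.Base using (∃; ∃₂; _×_; _,_; proj₁; proj₂)
open import Data.Sum.Base using (inj₁; inj₂)
open import Data.Unit.Base using (⊤; tt)
open import Data.Vec.Base as Vec using (Vec; []; _∷_; lookup; tabulate)
open import Data.Vec.Relation.Unary.All using (All)
open import Function.Base using (_∘_; const)
open import Function.Bundles using (_⇔_)
open import Level using (0ℓ)
open import Relation.Binary.Bundles using (TotalOrder)
open import Relation.Binary.PropositionalEquality
open import Relation.Binary.Structures using (IsDecTotalOrder)
open import Relation.Nullary.Decidable using (⌊_⌋; yes; no)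
open import Relation.Nullary.Negation using (contradiction)

-- The classical real numbers, given axiomatically as a Dedekind-complete
-- (decidably) totally ordered field.  Classically these axioms determine ℝ up
-- to isomorphism; _⁻¹ is total, and its value at 0# is unspecified.
record RealNumbers : Set₁ where
  infix  4 _≤_ _<_
  infixl 6 _+_ _-_
  infixl 7 _*_ _/_
  infix  8 -_
  infix  9 _⁻¹

  field
    ℝ   : Set
    _≤_ : ℝ → ℝ → Set
    _+_ : ℝ → ℝ → ℝ
    _*_ : ℝ → ℝ → ℝ
    -_  : ℝ → ℝ
    _⁻¹ : ℝ → ℝ
    0#  : ℝ
    1#  : ℝ

    isCommutativeRing : IsCommutativeRing _≡_ _+_ _*_ -_ 0# 1#
    isDecTotalOrder   : IsDecTotalOrder _≡_ _≤_

    0≢1         : 0# ≢ 1#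
    *-inverseʳ  : ∀ {x} → x ≢ 0# → x * x ⁻¹ ≡ 1#
    +-monoʳ-≤   : ∀ x {y z} → y ≤ z → x + y ≤ x + z
    *-nonneg    : ∀ {x y} → 0# ≤ x → 0# ≤ y → 0# ≤ x * y

  IsUpperBound : (ℝ → Set) → ℝ → Set
  IsUpperBound S u = ∀ {x} → S x → x ≤ u

  IsSupremum : (ℝ → Set) → ℝ → Set
  IsSupremum S s = IsUpperBound S s × (∀ {u} → IsUpperBound S u → s ≤ u)

  field
    complete : (S : ℝ → Set) → ∃ S → ∃ (IsUpperBound S) → ∃ (IsSupremum S)

  open IsDecTotalOrder isDecTotalOrder public
    using (_≤?_; _≟_; total; antisym; isTotalOrder)
    renaming (refl to ≤-refl; reflexive to ≤-reflexive; trans to ≤-trans)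

  commutativeRing : CommutativeRing 0ℓ 0ℓ
  commutativeRing = record { isCommutativeRing = isCommutativeRing }

  totalOrder : TotalOrder 0ℓ 0ℓ 0ℓ
  totalOrder = record { isTotalOrder = isTotalOrder }

  open CommutativeRing commutativeRing public
    using ( semiring; ring; +-comm; +-assoc; +-identityˡ; +-identityʳ; -‿inverseˡ
          ; -‿inverseʳ; *-comm; *-assoc; *-identityˡ; *-identityʳ; distribˡ; distribʳ
          ; zeroˡ; zeroʳ )

  open NaturalMax totalOrder public using (_⊔_)

  _<_ : ℝ → ℝ → Set
  x < y = x ≤ y × x ≢ y

  _-_ : ℝ → ℝ → ℝ
  x - y = x + - y

  _/_ : ℝ → ℝ → ℝ
  x / y = x * y ⁻¹

  open Mult semiring using (×1-homo-*) renaming (_×_ to _·_)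

  fromℕ : ℕ → ℝ
  fromℕ n = n · 1#

  sum : List ℝ → ℝ
  sum = List.foldr _+_ 0#

  open RingProperties ring using (-‿distribˡ-*; -‿involutive)

  0≤1 : 0# ≤ 1#
  0≤1 with total 0# 1#
  ... | inj₁ 0≤1 = 0≤1
  ... | inj₂ 1≤0 = subst (0# ≤_) square (*-nonneg 0≤-1 0≤-1)
    where
    0≤-1 : 0# ≤ - 1#
    0≤-1 = subst₂ _≤_ (-‿inverseˡ 1#) (+-identityʳ (- 1#)) (+-monoʳ-≤ (- 1#) 1≤0)

    square : - 1# * - 1# ≡ 1#
    square = begin
      - 1# * - 1#    ≡⟨ -‿distribˡ-* 1# (- 1#) ⟨
      - (1# * - 1#)  ≡⟨ cong -_ (*-identityˡ (- 1#)) ⟩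
      - (- 1#)       ≡⟨ -‿involutive 1# ⟩
      1#             ∎
      where open ≡-Reasoning

  +-monoˡ-≤ : ∀ x {y z} → y ≤ z → y + x ≤ z + x
  +-monoˡ-≤ x {y} {z} y≤z = subst₂ _≤_ (+-comm x y) (+-comm x z) (+-monoʳ-≤ x y≤z)

  +-mono-≤ : ∀ {w x y z} → w ≤ x → y ≤ z → w + y ≤ x + z
  +-mono-≤ {x = x} {y} w≤x y≤z = ≤-trans (+-monoˡ-≤ y w≤x) (+-monoʳ-≤ x y≤z)

  *-monoˡ-≤ : ∀ {x y z} → 0# ≤ x → y ≤ z → y * x ≤ z * x
  *-monoˡ-≤ {x} {y} {z} 0≤x y≤z = subst₂ _≤_ (+-identityʳ (y * x)) rearrange
    (+-monoʳ-≤ (y * x) (*-nonneg 0≤z-y 0≤x))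
    where
    0≤z-y : 0# ≤ z - y
    0≤z-y = subst (_≤ z - y) (-‿inverseʳ y) (+-monoˡ-≤ (- y) y≤z)

    rearrange : y * x + (z - y) * x ≡ z * x
    rearrange = begin
      y * x + (z - y) * x  ≡⟨ distribʳ x y (z - y) ⟨
      (y + (z - y)) * x    ≡⟨ cong (_* x) (+-comm y (z - y)) ⟩
      ((z - y) + y) * x    ≡⟨ cong (_* x) (+-assoc z (- y) y) ⟩
      (z + (- y + y)) * x  ≡⟨ cong (λ w → (z + w) * x) (-‿inverseˡ y) ⟩
      (z + 0#) * x         ≡⟨ cong (_* x) (+-identityʳ z) ⟩
      z * x                ∎
      where open ≡-Reasoning

  0≤fromℕ : ∀ n → 0# ≤ fromℕ n
  0≤fromℕ zero    = ≤-refl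
  0≤fromℕ (suc n) = subst (_≤ fromℕ (suc n)) (+-identityʳ 0#) (+-mono-≤ 0≤1 (0≤fromℕ n))

  fromℕ-mono-≤ : ∀ {m n} → m ℕ.≤ n → fromℕ m ≤ fromℕ n
  fromℕ-mono-≤ {n = n} z≤n = 0≤fromℕ n
  fromℕ-mono-≤ (s≤s m≤n)   = +-monoʳ-≤ 1# (fromℕ-mono-≤ m≤n)

  1≤fromℕ-suc : ∀ n → 1# ≤ fromℕ (suc n)
  1≤fromℕ-suc n = subst (_≤ fromℕ (suc n)) (+-identityʳ 1#) (fromℕ-mono-≤ (s≤s (z≤n {n})))

  fromℕ-suc≢0 : ∀ n → fromℕ (suc n) ≢ 0#
  fromℕ-suc≢0 n eq = 0≢1 (antisym 0≤1 (subst (1# ≤_) eq (1≤fromℕ-suc n)))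

  ⁻¹-nonneg : ∀ {x} → 0# ≤ x → x ≢ 0# → 0# ≤ x ⁻¹
  ⁻¹-nonneg {x} 0≤x x≢0 with total 0# (x ⁻¹)
  ... | inj₁ 0≤x⁻¹ = 0≤x⁻¹
  ... | inj₂ x⁻¹≤0 = contradiction (antisym 0≤1 1≤0) 0≢1
    where
    1≤0 : 1# ≤ 0#
    1≤0 = subst₂ _≤_ (trans (*-comm (x ⁻¹) x) (*-inverseʳ x≢0)) (zeroˡ x) (*-monoˡ-≤ 0≤x x⁻¹≤0)

  -- p/q ≤ log₂ n for positive q iff 2ᵖ ≤ n^q.
  RationalBelowLog₂ : ℕ → ℝ → Set
  RationalBelowLog₂ n x =
    ∃₂ λ p q → 2 ℕ.^ p ℕ.≤ n ℕ.^ suc q × x ≡ fromℕ p / fromℕ (suc q)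

  RationalBelowLog₂-bounded : ∀ n → IsUpperBound (RationalBelowLog₂ n) (fromℕ n)
  RationalBelowLog₂-bounded n (p , q , 2^p≤n^q , refl) =
    subst (fromℕ p / d ≤_) cancel
      (*-monoˡ-≤ (⁻¹-nonneg (0≤fromℕ (suc q)) (fromℕ-suc≢0 q)) (fromℕ-mono-≤ p≤nq))
    where
    d = fromℕ (suc q)

    n≤2^n : ∀ n → n ℕ.≤ 2 ℕ.^ n
    n≤2^n zero    = z≤n
    n≤2^n (suc n) = ℕ.≤-trans (ℕ.+-mono-≤ (ℕ.m^n>0 2 n) (n≤2^n n))
      (ℕ.≤-reflexive (cong (2 ℕ.^ n ℕ.+_) (sym (ℕ.+-identityʳ (2 ℕ.^ n)))))

    p≤nq : p ℕ.≤ n ℕ.* suc q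
    p≤nq with p ℕ.≤? n ℕ.* suc q
    ... | yes p≤nq = p≤nq
    ... | no  p≰nq = contradiction
      (ℕ.<-≤-trans (ℕ.^-monoʳ-< 2 (s≤s (s≤s z≤n)) (ℕ.≰⇒> p≰nq))
        (ℕ.≤-trans 2^p≤n^q (ℕ.≤-trans (ℕ.^-monoˡ-≤ (suc q) (n≤2^n n))
          (ℕ.≤-reflexive (ℕ.^-*-assoc 2 n (suc q))))))
      (ℕ.<-irrefl refl)

    cancel : fromℕ (n ℕ.* suc q) * d ⁻¹ ≡ fromℕ n
    cancel = begin
      fromℕ (n ℕ.* suc q) * d ⁻¹  ≡⟨ cong (_* d ⁻¹) (×1-homo-* n (suc q)) ⟩
      fromℕ n * d * d ⁻¹          ≡⟨ *-assoc (fromℕ n) d (d ⁻¹) ⟩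
      fromℕ n * (d * d ⁻¹)        ≡⟨ cong (fromℕ n *_) (*-inverseʳ (fromℕ-suc≢0 q)) ⟩
      fromℕ n * 1#                ≡⟨ *-identityʳ (fromℕ n) ⟩
      fromℕ n                     ∎
      where open ≡-Reasoning

  log₂-supremum : (n : ℕ) .{{_ : NonZero n}} → ∃ (IsSupremum (RationalBelowLog₂ n))
  log₂-supremum n = complete (RationalBelowLog₂ n)
    (_ , 0 , 0 , ℕ.m^n>0 n 1 , refl)
    (fromℕ n , RationalBelowLog₂-bounded n)

  log₂ : (n : ℕ) .{{_ : NonZero n}} → ℝ
  log₂ n = proj₁ (log₂-supremum n)

-- Every permutation of Fin n, listed exactly once (up to Perm._≈_).
permutations : ∀ n → List (Permutation′ n)
permutations zero    = Perm.id ∷ []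
permutations (suc n) = cartesianProductWith (Perm.insert zero) (allFin (suc n)) (permutations n)

permutations-length : ∀ n → length (permutations n) ≡ n !
permutations-length zero    = refl
permutations-length (suc n) = trans
  (length-product (Perm.insert zero) (allFin (suc n)) (permutations n))
  (cong₂ ℕ._*_ (List.length-tabulate {n = suc n} (λ i → i)) (permutations-length n))
  where
  length-product : {A B C : Set} (f : A → B → C) (xs : List A) (ys : List B) →
                   length (cartesianProductWith f xs ys) ≡ length xs ℕ.* length ys
  length-product f []       ys = refl
  length-product f (x ∷ xs) ys = trans (List.length-++ (List.map (f x) ys))
    (cong₂ ℕ._+_ (List.length-map (f x) ys) (length-product f xs ys))

permutations-complete : ∀ n (π : Permutation′ n) → Any (π Perm.≈_) (permutations n)
permutations-complete zero    π = here λ ()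
permutations-complete (suc n) π = Any.cartesianProductWith⁺ (Perm.insert zero)
  (λ {j} {ρ} → glue {j} {ρ})
  (∈-allFin (π ⟨$⟩ʳ zero)) (permutations-complete n (Perm.remove zero π))
  where
  glue : ∀ {j ρ} → π ⟨$⟩ʳ zero ≡ j → Perm.remove zero π Perm.≈ ρ → π Perm.≈ Perm.insert zero j ρ
  glue eq π≈ρ zero    = eq
  glue {ρ = ρ} refl π≈ρ (suc k) = trans (Perm.punchIn-permute π zero k)
    (trans (cong (punchIn (π ⟨$⟩ʳ zero)) (π≈ρ k))
           (sym (Perm.insert-punchIn zero (π ⟨$⟩ʳ zero) ρ k)))

module _ (𝓡 : RealNumbers) where
  open RealNumbers 𝓡

  -- Subsets of Ω are Bool-valued, matching the classical reading of the reals.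
  record ProbabilitySpace : Set₁ where
    field
      Ω            : Set
      IsMeasurable : (Ω → Bool) → Set
      -- Only meaningful on measurable subsets.
      P            : (Ω → Bool) → ℝ

    IsUnion : (ℕ → Ω → Bool) → (Ω → Bool) → Set
    IsUnion A B = ∀ ω → B ω ≡ true ⇔ ∃ λ i → A i ω ≡ true

    PairwiseDisjoint : (ℕ → Ω → Bool) → Set
    PairwiseDisjoint A = ∀ i j → i ≢ j → ∀ ω → A i ω ∧ A j ω ≡ false

    field
      whole-measurable      : IsMeasurable (const true)
      complement-measurable : ∀ {A} → IsMeasurable A → IsMeasurable (not ∘ A)
      union-measurable      : ∀ {A B} → (∀ i → IsMeasurable (A i)) → IsUnion A B → IsMeasurable B

      P-nonneg     : ∀ {A} → IsMeasurable A → 0# ≤ P A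
      P-whole      : P (const true) ≡ 1#
      -- A series of nonnegative terms is the supremum of its partial sums.
      P-σ-additive : ∀ {A B} → (∀ i → IsMeasurable (A i)) → PairwiseDisjoint A → IsUnion A B →
                     IsSupremum (λ x → ∃ λ k → x ≡ sum (List.map (P ∘ A) (List.upTo k))) (P B)

    IsRandomVariable : (Ω → ℝ) → Set
    IsRandomVariable f = ∀ t → IsMeasurable (λ ω → ⌊ f ω ≤? t ⌋)

    -- Simple functions Σⱼ cⱼ·1_{Aⱼ} with cⱼ ≥ 0; the Aⱼ need not be disjoint.
    record Term : Set where
      field
        coefficient : ℝ
        nonneg      : 0# ≤ coefficient
        event       : Ω → Bool
        measurable  : IsMeasurable event

    open Term

    value : List Term → Ω → ℝ
    value s ω = sum (List.map (λ t → if event t ω then coefficient t else 0#) s)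

    integral : List Term → ℝ
    integral s = sum (List.map (λ t → coefficient t * P (event t)) s)

    -- The Lebesgue integral of a nonnegative random variable f is e.  For
    -- bounded f such an e exists by completeness, and it is unique.
    IsExpectation : (Ω → ℝ) → ℝ → Set
    IsExpectation f e =
      IsSupremum (λ x → ∃ λ s → (∀ ω → value s ω ≤ f ω) × x ≡ integral s) e

  data Threshold : Set where
    finite : (θ : ℝ) → 0# ≤ θ → Threshold
    ∞      : Threshold

  data Outcome : Set where
    passed : Outcome
    failed : (x : ℝ) → Outcome

  test : Threshold → ℝ → Outcome
  test (finite θ _) x = if ⌊ x ≤? θ ⌋ then failed x else passed
  test ∞            x = failed x

  remainingUtility : Threshold → ℝ → ℝ
  remainingUtility (finite θ _) x = (x - θ) ⊔ 0#
  remainingUtility ∞            x = 0#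

  -- The outcomes of all previous tests, latest first.
  History : Set
  History = List Outcome

  record Strategy : Set where
    field
      threshold : History → Threshold
      accept    : History → Outcome → Bool

  open Strategy

  -- The score obtained on the remaining values, after the given history.
  play : Strategy → History → ∀ {n} → Vec ℝ n → ℝ
  play s h []       = 0#
  play s h (x ∷ xs) =
    if accept s h o then remainingUtility (threshold s h) x else play s (o ∷ h) xs
    where o = test (threshold s h) x

  score : Strategy → ∀ {n} → Vec ℝ n → ℝ
  score s = play s []

  IsInstance : ∀ {n} → Vec ℝ n → Set
  IsInstance = All (0# ≤_)

  -- For nonnegative entries the initial value 0# is immaterial unless n = 0.
  maximum : ∀ {n} → Vec ℝ n → ℝ
  maximum = Vec.foldr′ _⊔_ 0#

  permute : ∀ {n} → Permutation′ n → Vec ℝ n → Vec ℝ n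
  permute σ a = tabulate λ i → lookup a (σ ⟨$⟩ʳ i)

  data Information : Set where
    fullInformation optimumInformation noInformation : Information

  Given : Information → ℕ → Set
  Given fullInformation    n = Vec ℝ n
  Given optimumInformation n = ℝ
  Given noInformation      n = ⊤

  inform : ∀ I {n} → Vec ℝ n → Given I n
  inform fullInformation    a = a
  inform optimumInformation a = maximum a
  inform noInformation      a = tt

  -- A point ω of the probability space is an outcome of the internal
  -- randomness; its distribution does not depend on the arrival order.
  record Player (I : Information) (n : ℕ) : Set₁ where
    field
      randomness : ProbabilitySpace

    open ProbabilitySpace randomness public

    field
      strategy : Given I n → Ω → Strategy

    randomScore : Vec ℝ n → Permutation′ n → Ω → ℝ
    randomScore a σ ω = score (strategy (inform I a) ω) (permute σ a)

    field
      score-measurable : ∀ a → IsInstance a → ∀ σ → IsRandomVariable (randomScore a σ)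

  module _ {I : Information} {n : ℕ} (α : ℝ) (player : Player I n) where
    open Player player

    CompetitiveInRandomOrder : Set
    CompetitiveInRandomOrder = ∀ a → IsInstance a →
      ∃ λ (e : Permutation′ n → ℝ) →
        (∀ σ → IsExpectation (randomScore a σ) (e σ)) ×
        α ⁻¹ * maximum a ≤ sum (List.map e (permutations n)) / fromℕ (n !)

    CompetitiveInArbitraryOrder : Set
    CompetitiveInArbitraryOrder = ∀ a → IsInstance a → ∀ σ →
      ∃ λ e → IsExpectation (randomScore a σ) e × α ⁻¹ * maximum a ≤ e

{-# OPTIONS --safe #-}
module Submission where

open import Defs
open import Data.Nat.Base as ℕ using (ℕ; zero; suc; NonZero; _!; z≤n; s≤s)
import Data.Nat.Properties as ℕ
open import Data.Product.Base using (∃; _×_; _,_; proj₁; proj₂)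
open import Algebra.Bundles using (CommutativeRing)
import Algebra.Construct.NaturalChoice.Max as NaturalMax
import Algebra.Construct.NaturalChoice.MaxOp as MaxOp
import Algebra.Properties.Semiring.Exp as Exp
import Algebra.Properties.Semiring.Mult as Mult
import Algebra.Solver.Ring.NaturalCoefficients.Default as SemiringSolver
open import Data.Bool.Base using (Bool; true; false; if_then_else_; not; _∧_; _∨_)
open import Data.Bool.Properties using (∧-comm; ∧-zeroʳ; ∨-identityʳ; ∨-zeroʳ; ∨-idem)
open import Data.Fin.Base using (Fin; zero; suc; punchIn)
open import Data.Fin.Permutation as Perm using (Permutation′; _⟨$⟩ʳ_)
open import Data.List.Base as List using (List; []; _∷_; _++_; allFin; cartesianProductWith; length)
import Data.List.Properties as List
open import Data.Sum.Base using (inj₁; inj₂)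
open import Data.Vec.Base as Vec using (Vec; []; _∷_; lookup; removeAt)
import Data.Vec.Properties as Vec
open import Data.Vec.Membership.DecPropositional ℕ._≟_ using (_∈_; _∈?_)
open import Data.Vec.Membership.Propositional.Properties using (∈-++⁺ʳ; ∈-map⁺)
open import Data.Vec.Relation.Unary.All as All using (All; []; _∷_)
import Data.Vec.Relation.Unary.All.Properties as All
open import Data.Vec.Relation.Unary.Any as Any using (here; there)
import Data.Vec.Relation.Unary.Any.Properties as Any
open import Function.Base using (_∘_; const; id)
open import Function.Bundles using (mk⇔)
open import Relation.Binary.Bundles using (TotalOrder)
import Relation.Binary.Reasoning.PartialOrder as PartialOrderReasoning
open import Relation.Binary.PropositionalEquality
open import Relation.Nullary.Decidable using (⌊_⌋; yes; no; ¬?; decidable-stable)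
open import Relation.Nullary.Negation using (¬_; contradiction)

-- Both cases use Yao's principle with values drawn from a truncated geometric
-- distribution on 0, …, M, where M = Θ(log n): by memorylessness, accepting a
-- passed test gains at most 2 on average, whatever the threshold.
--
-- Random order, known maximum: one option of value M is hidden among n - 1 iid
-- draws.  To gain M - θ from it the player must accept a passed test at θ; an
-- iid option passes with probability at least 2⁻ᴹ (M - θ), so by the time all
-- n ≥ 2ᴹ positions are charged the hidden option contributes at most the
-- probability, at most 1, that the player stops in a purely iid sequence.
--
-- Arbitrary order, full information: the multiset is fixed, and the adversary
-- draws geometric values from stock.  Supplies growing by a factor of 5 from
-- each level to the next lower one make the levels run out from the top down
-- with overwhelming probability, so that the truncated geometric law persists
-- to the end; an exponential martingale bounds the failure probability by 1/M.

-- Arithmetic of the ordered field and finite sums.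

module RealProperties (𝓡 : RealNumbers) where
  open RealNumbers 𝓡
  open CommutativeRing commutativeRing using (commutativeSemiring)
  open SemiringSolver commutativeSemiring public
    using (solve; _:=_; _:+_; _:*_; con; Polynomial)
  open Exp semiring public using (_^_; ^-homo-*)
  open Mult semiring using (×1-homo-*)

  nat : ∀ {n} → ℕ → Polynomial n
  nat zero    = con 0
  nat (suc m) = con 1 :+ nat m

  module ≤-Reasoning = PartialOrderReasoning (TotalOrder.poset totalOrder)
  open ≤-Reasoning

  open NaturalMax totalOrder public using (x≤y⇒x⊔y≈y)
  open MaxOp (NaturalMax.maxOperator totalOrder) public
    using (x≤x⊔y; x≤y⊔x; ⊔-lub)

  ≰⇒≥ : ∀ {x y} → ¬ x ≤ y → y ≤ x
  ≰⇒≥ {x} {y} x≰y with total x y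
  ... | inj₁ x≤y = contradiction x≤y x≰y
  ... | inj₂ y≤x = y≤x

  a-b+b≡a : ∀ a b → a - b + b ≡ a
  a-b+b≡a a b = trans (+-assoc a (- b) b) (trans (cong (a +_) (-‿inverseˡ b)) (+-identityʳ a))

  a+b-b≡a : ∀ a b → a + b - b ≡ a
  a+b-b≡a a b = trans (+-assoc a b (- b)) (trans (cong (a +_) (-‿inverseʳ b)) (+-identityʳ a))

  a≤b+c⇒a-c≤b : ∀ {a b c} → a ≤ b + c → a - c ≤ b
  a≤b+c⇒a-c≤b {a} {b} {c} a≤b+c = subst (a - c ≤_) (a+b-b≡a b c) (+-monoˡ-≤ (- c) a≤b+c)

  a≤b-c⇒a+c≤b : ∀ {a b c} → a ≤ b - c → a + c ≤ b
  a≤b-c⇒a+c≤b {a} {b} {c} a≤b-c = subst (a + c ≤_) (a-b+b≡a b c) (+-monoˡ-≤ c a≤b-c)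

  a+c≤b⇒a≤b-c : ∀ {a b c} → a + c ≤ b → a ≤ b - c
  a+c≤b⇒a≤b-c {a} {b} {c} a+c≤b = subst (_≤ b - c) (a+b-b≡a a c) (+-monoˡ-≤ (- c) a+c≤b)

  x≤x+y : ∀ x {y} → 0# ≤ y → x ≤ x + y
  x≤x+y x {y} 0≤y = subst (_≤ x + y) (+-identityʳ x) (+-monoʳ-≤ x 0≤y)

  x≤y+x : ∀ {x y} → 0# ≤ y → x ≤ y + x
  x≤y+x {x} {y} 0≤y = subst (x ≤_) (+-comm x y) (x≤x+y x 0≤y)

  +-nonneg : ∀ {x y} → 0# ≤ x → 0# ≤ y → 0# ≤ x + y
  +-nonneg 0≤x 0≤y = ≤-trans 0≤x (x≤x+y _ 0≤y)

  *-monoʳ-≤ : ∀ {x y z} → 0# ≤ x → y ≤ z → x * y ≤ x * z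
  *-monoʳ-≤ {x} {y} {z} 0≤x y≤z = subst₂ _≤_ (*-comm y x) (*-comm z x) (*-monoˡ-≤ 0≤x y≤z)

  *-mono-≤ : ∀ {w x y z} → 0# ≤ w → 0# ≤ z → w ≤ x → y ≤ z → w * y ≤ x * z
  *-mono-≤ 0≤w 0≤z w≤x y≤z = ≤-trans (*-monoʳ-≤ 0≤w y≤z) (*-monoˡ-≤ 0≤z w≤x)

  fromℕ-homo-* : ∀ m n → fromℕ (m ℕ.* n) ≡ fromℕ m * fromℕ n
  fromℕ-homo-* = ×1-homo-*

  2# 3# : ℝ
  2# = fromℕ 2
  3# = fromℕ 3

  0≤2 : 0# ≤ 2#
  0≤2 = 0≤fromℕ 2

  1≤2 : 1# ≤ 2#
  1≤2 = 1≤fromℕ-suc 1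

  ½ : ℝ
  ½ = 2# ⁻¹

  0≤½ : 0# ≤ ½
  0≤½ = ⁻¹-nonneg 0≤2 (fromℕ-suc≢0 1)

  ½*2≡1 : ½ * 2# ≡ 1#
  ½*2≡1 = trans (*-comm ½ 2#) (*-inverseʳ (fromℕ-suc≢0 1))

  ½*2x≡x : ∀ x → ½ * (2# * x) ≡ x
  ½*2x≡x x = trans (sym (*-assoc ½ 2# x)) (trans (cong (_* x) ½*2≡1) (*-identityˡ x))

  ½*[x+x]≡x : ∀ x → ½ * (x + x) ≡ x
  ½*[x+x]≡x x = trans (cong (½ *_) (solve 1 (λ x → x :+ x := nat 2 :* x) refl x)) (½*2x≡x x)

  ½+½≡1 : ½ + ½ ≡ 1#
  ½+½≡1 = trans (solve 1 (λ h → h :+ h := h :* nat 2) refl ½) ½*2≡1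

  ½≤1 : ½ ≤ 1#
  ½≤1 = subst (½ ≤_) ½+½≡1 (x≤x+y ½ 0≤½)

  ^-nonneg : ∀ {x} → 0# ≤ x → ∀ n → 0# ≤ x ^ n
  ^-nonneg 0≤x zero    = 0≤1
  ^-nonneg 0≤x (suc n) = *-nonneg 0≤x (^-nonneg 0≤x n)

  ^-≤1 : ∀ {x} → 0# ≤ x → x ≤ 1# → ∀ n → x ^ n ≤ 1#
  ^-≤1         0≤x x≤1 zero    = ≤-refl
  ^-≤1 {x = x} 0≤x x≤1 (suc n) = subst (x * x ^ n ≤_) (*-identityʳ 1#)
    (*-mono-≤ 0≤x 0≤1 x≤1 (^-≤1 0≤x x≤1 n))

  ^-antimono-≤ : ∀ {x} → 0# ≤ x → x ≤ 1# → ∀ {m n} → m ℕ.≤ n → x ^ n ≤ x ^ m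
  ^-antimono-≤ 0≤x x≤1 {n = n} z≤n = ^-≤1 0≤x x≤1 n
  ^-antimono-≤ 0≤x x≤1 (s≤s m≤n)   = *-monoʳ-≤ 0≤x (^-antimono-≤ 0≤x x≤1 m≤n)

  sum-++ : ∀ xs ys → sum (xs ++ ys) ≡ sum xs + sum ys
  sum-++ []       ys = sym (+-identityˡ _)
  sum-++ (x ∷ xs) ys = trans (cong (x +_) (sum-++ xs ys)) (sym (+-assoc x _ _))

  module _ {A : Set} where

    sum-map-cong : ∀ {f g : A → ℝ} → (∀ a → f a ≡ g a) →
                   ∀ xs → sum (List.map f xs) ≡ sum (List.map g xs)
    sum-map-cong f≡g xs = cong sum (List.map-cong f≡g xs)

    sum-map-≤ : ∀ {f g : A → ℝ} → (∀ a → f a ≤ g a) →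
                ∀ xs → sum (List.map f xs) ≤ sum (List.map g xs)
    sum-map-≤ f≤g []       = ≤-refl
    sum-map-≤ f≤g (x ∷ xs) = +-mono-≤ (f≤g x) (sum-map-≤ f≤g xs)

    sum-map-const : ∀ c (xs : List A) → sum (List.map (const c) xs) ≡ fromℕ (length xs) * c
    sum-map-const c []       = sym (zeroˡ c)
    sum-map-const c (x ∷ xs) = trans (cong (c +_) (sum-map-const c xs))
      (solve 2 (λ c l → c :+ l :* c := (con 1 :+ l) :* c) refl c (fromℕ (length xs)))

  sum-cartesianProductWith : ∀ {A B C : Set} (f : A → B → C) (g : C → ℝ) xs ys →
    sum (List.map g (cartesianProductWith f xs ys)) ≡
    sum (List.map (λ x → sum (List.map (g ∘ f x) ys)) xs)
  sum-cartesianProductWith f g []       ys = refl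
  sum-cartesianProductWith f g (x ∷ xs) ys = trans
    (cong sum (List.map-++ g (List.map (f x) ys) _))
    (trans (sum-++ (List.map g (List.map (f x) ys)) _)
      (cong₂ _+_ (cong sum (sym (List.map-∘ ys))) (sum-cartesianProductWith f g xs ys)))

-- Finite distributions as trees of fair coin flips, for the adversary's randomness.

data Coins (A : Set) : Set where
  pure : A → Coins A
  flip : Coins A → Coins A → Coins A

module _ {A : Set} where

  infixl 1 _>>=_
  _>>=_ : ∀ {B : Set} → Coins A → (A → Coins B) → Coins B
  pure a   >>= k = k a
  flip l r >>= k = flip (l >>= k) (r >>= k)

  map : ∀ {B : Set} → (A → B) → Coins A → Coins B
  map f d = d >>= λ a → pure (f a)

  -- Facts such as `v ≤ K` for a draw from `geo K` hold only at the leaves of the tree, not for all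
  -- elements of the type.
  Support : (A → Set) → Coins A → Set
  Support P (pure a)   = P a
  Support P (flip l r) = Support P l × Support P r

module _ {A : Set} {P : A → Set} where

  support-universal : (∀ a → P a) → ∀ d → Support P d
  support-universal p (pure a)   = p a
  support-universal p (flip l r) = support-universal p l , support-universal p r

  support-bind : ∀ {B : Set} {Q : B → Set} {k : A → Coins B} (d : Coins A) →
                 Support P d → (∀ a → P a → Support Q (k a)) → Support Q (d >>= k)
  support-bind (pure a)   p         q = q a p
  support-bind (flip l r) (pl , pr) q = support-bind l pl q , support-bind r pr q

-- Expectation over coin flips.

module CoinExpectation (𝓡 : RealNumbers) where
  open RealNumbers 𝓡
  open RealProperties 𝓡

  𝔼 : ∀ {A : Set} → Coins A → (A → ℝ) → ℝ
  𝔼 (pure a)   f = f a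
  𝔼 (flip l r) f = ½ * (𝔼 l f + 𝔼 r f)

  module _ {A : Set} where

    𝔼-mono : ∀ {P : A → Set} {f g : A → ℝ} (d : Coins A) → Support P d →
             (∀ a → P a → f a ≤ g a) → 𝔼 d f ≤ 𝔼 d g
    𝔼-mono (pure a)   p         f≤g = f≤g a p
    𝔼-mono (flip l r) (pl , pr) f≤g =
      *-monoʳ-≤ 0≤½ (+-mono-≤ (𝔼-mono l pl f≤g) (𝔼-mono r pr f≤g))

    𝔼-monotone : ∀ {f g : A → ℝ} (d : Coins A) → (∀ a → f a ≤ g a) → 𝔼 d f ≤ 𝔼 d g
    𝔼-monotone d f≤g = 𝔼-mono {P = λ a → a ≡ a} d (support-universal (λ _ → refl) d) (λ a _ → f≤g a)

    𝔼-cong : ∀ {P : A → Set} {f g : A → ℝ} (d : Coins A) → Support P d →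
             (∀ a → P a → f a ≡ g a) → 𝔼 d f ≡ 𝔼 d g
    𝔼-cong (pure a)   p         f≡g = f≡g a p
    𝔼-cong (flip l r) (pl , pr) f≡g =
      cong (½ *_) (cong₂ _+_ (𝔼-cong l pl f≡g) (𝔼-cong r pr f≡g))

    𝔼-ext : ∀ {f g : A → ℝ} (d : Coins A) → (∀ a → f a ≡ g a) → 𝔼 d f ≡ 𝔼 d g
    𝔼-ext d f≡g = 𝔼-cong {P = λ a → a ≡ a} d (support-universal (λ _ → refl) d) (λ a _ → f≡g a)

    𝔼-const : ∀ c (d : Coins A) → 𝔼 d (const c) ≡ c
    𝔼-const c (pure a)   = refl
    𝔼-const c (flip l r) = trans (cong (½ *_) (cong₂ _+_ (𝔼-const c l) (𝔼-const c r))) (½*[x+x]≡x c)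

    𝔼-≤ : ∀ {f : A → ℝ} {c} (d : Coins A) → (∀ a → f a ≤ c) → 𝔼 d f ≤ c
    𝔼-≤ {f} d f≤c = subst (𝔼 d f ≤_) (𝔼-const _ d) (𝔼-monotone d f≤c)

    𝔼-≥ : ∀ {f : A → ℝ} {c} (d : Coins A) → (∀ a → c ≤ f a) → c ≤ 𝔼 d f
    𝔼-≥ {f} d c≤f = subst (_≤ 𝔼 d f) (𝔼-const _ d) (𝔼-monotone d c≤f)

    𝔼-+ : ∀ (d : Coins A) (f g : A → ℝ) → 𝔼 d (λ a → f a + g a) ≡ 𝔼 d f + 𝔼 d g
    𝔼-+ (pure a)   f g = refl
    𝔼-+ (flip l r) f g = trans (cong (½ *_) (cong₂ _+_ (𝔼-+ l f g) (𝔼-+ r f g)))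
      (solve 5 (λ h a b c d → h :* ((a :+ b) :+ (c :+ d)) := h :* (a :+ c) :+ h :* (b :+ d)) refl
        ½ (𝔼 l f) (𝔼 l g) (𝔼 r f) (𝔼 r g))

    𝔼-* : ∀ (d : Coins A) c (f : A → ℝ) → 𝔼 d (λ a → c * f a) ≡ c * 𝔼 d f
    𝔼-* (pure a)   c f = refl
    𝔼-* (flip l r) c f = trans (cong (½ *_) (cong₂ _+_ (𝔼-* l c f) (𝔼-* r c f)))
      (solve 4 (λ h c a b → h :* (c :* a :+ c :* b) := c :* (h :* (a :+ b))) refl
        ½ c (𝔼 l f) (𝔼 r f))

    𝔼-sum : ∀ {B : Set} (d : Coins A) (f : A → B → ℝ) xs →
            𝔼 d (λ a → sum (List.map (f a) xs)) ≡ sum (List.map (λ x → 𝔼 d (λ a → f a x)) xs)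
    𝔼-sum d f []       = 𝔼-const 0# d
    𝔼-sum d f (x ∷ xs) = trans (𝔼-+ d (λ a → f a x) _) (cong (_ +_) (𝔼-sum d f xs))

    𝔼-bind : ∀ {B : Set} (d : Coins A) (k : A → Coins B) f → 𝔼 (d >>= k) f ≡ 𝔼 d (λ a → 𝔼 (k a) f)
    𝔼-bind (pure a)   k f = refl
    𝔼-bind (flip l r) k f = cong (½ *_) (cong₂ _+_ (𝔼-bind l k f) (𝔼-bind r k f))

    𝔼-map : ∀ {B : Set} (d : Coins A) (h : A → B) f → 𝔼 (map h d) f ≡ 𝔼 d (f ∘ h)
    𝔼-map d h f = 𝔼-bind d (λ a → pure (h a)) f

  𝔼-swap : ∀ {A B : Set} (d : Coins A) (d′ : Coins B) (f : A → B → ℝ) →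
           𝔼 d (λ a → 𝔼 d′ (f a)) ≡ 𝔼 d′ (λ b → 𝔼 d (λ a → f a b))
  𝔼-swap (pure a)   d′ f = refl
  𝔼-swap (flip l r) d′ f = trans
    (cong (½ *_) (trans (cong₂ _+_ (𝔼-swap l d′ f) (𝔼-swap r d′ f)) (sym (𝔼-+ d′ _ _))))
    (sym (𝔼-* d′ ½ _))

-- Measure and lower integral on the player's probability space.

module LowerIntegral (𝓡 : RealNumbers) (space : ProbabilitySpace 𝓡) where
  open RealNumbers 𝓡
  open RealProperties 𝓡
  open CoinExpectation 𝓡
  open ProbabilitySpace space
  open Term
  open ≤-Reasoning

  infixr 7 _∩_ _∖_
  _∩_ _∖_ : (Ω → Bool) → (Ω → Bool) → Ω → Bool
  (A ∩ B) ω = A ω ∧ B ω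
  (A ∖ B) ω = A ω ∧ not (B ω)

  ∅ : Ω → Bool
  ∅ = const false

  ∅-measurable : IsMeasurable ∅
  ∅-measurable = complement-measurable whole-measurable

  -- Padding with empty sets turns the countable axioms into their finite versions.
  pair : (Ω → Bool) → (Ω → Bool) → ℕ → Ω → Bool
  pair A B 0             = A
  pair A B 1             = B
  pair A B (suc (suc _)) = ∅

  pair-measurable : ∀ {A B} → IsMeasurable A → IsMeasurable B → ∀ i → IsMeasurable (pair A B i)
  pair-measurable A-m B-m 0             = A-m
  pair-measurable A-m B-m 1             = B-m
  pair-measurable A-m B-m (suc (suc _)) = ∅-measurable

  pair-union : ∀ {A B C} → (∀ ω → C ω ≡ A ω ∨ B ω) → IsUnion (pair A B) C
  pair-union {A} {B} {C} C≡A∨B ω = mk⇔ (to (C≡A∨B ω)) from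
    where
    to : C ω ≡ A ω ∨ B ω → C ω ≡ true → ∃ λ i → pair A B i ω ≡ true
    to eq Cω with A ω in Aω
    ... | true  = 0 , Aω
    ... | false = 1 , trans (sym eq) Cω

    from : (∃ λ i → pair A B i ω ≡ true) → C ω ≡ true
    from (0 , Aω) = trans (C≡A∨B ω) (cong (_∨ B ω) Aω)
    from (1 , Bω) = trans (C≡A∨B ω) (trans (cong (A ω ∨_) Bω) (∨-zeroʳ (A ω)))
    from (suc (suc _) , ())

  ∪-measurable : ∀ {A B C} → IsMeasurable A → IsMeasurable B → (∀ ω → C ω ≡ A ω ∨ B ω) →
                 IsMeasurable C
  ∪-measurable A-m B-m C≡A∨B = union-measurable (pair-measurable A-m B-m) (pair-union C≡A∨B)

  -- Pointwise equal events need not be equal functions. The union axiom describes the union only by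
  -- membership, so writing `B` as the union of `A` with itself transfers measurability.
  measurable-cong : ∀ {A B} → IsMeasurable A → (∀ ω → B ω ≡ A ω) → IsMeasurable B
  measurable-cong {A} A-m B≡A = ∪-measurable A-m A-m λ ω → trans (B≡A ω) (sym (∨-idem (A ω)))

  ∩-measurable : ∀ {A B} → IsMeasurable A → IsMeasurable B → IsMeasurable (A ∩ B)
  ∩-measurable {A} {B} A-m B-m = measurable-cong
    (complement-measurable (∪-measurable (complement-measurable A-m) (complement-measurable B-m)
      λ ω → refl))
    λ ω → de-morgan (A ω) (B ω)
    where
    de-morgan : ∀ a b → a ∧ b ≡ not (not a ∨ not b)
    de-morgan true  true  = refl
    de-morgan true  false = refl
    de-morgan false b     = refl

  ∖-measurable : ∀ {A B} → IsMeasurable A → IsMeasurable B → IsMeasurable (A ∖ B)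
  ∖-measurable A-m B-m = ∩-measurable A-m (complement-measurable B-m)

  -- The union of countably many empty sets is empty, and the partial sum of two terms already gives
  -- `P ∅ + P ∅ ≤ P ∅`.
  P-∅ : P ∅ ≡ 0#
  P-∅ = antisym
    (subst₂ _≤_ (trans (a+b-b≡a _ _) (+-identityʳ _)) (-‿inverseʳ (P ∅))
      (+-monoˡ-≤ (- P ∅)
        (subst (_≤ P ∅) (+-comm (P ∅) (P ∅ + 0#))
          (proj₁ (P-σ-additive (λ _ → ∅-measurable) (λ _ _ _ _ → refl) ∅-union) (2 , refl)))))
    (P-nonneg ∅-measurable)
    where
    ∅-union : IsUnion (λ _ → ∅) ∅
    ∅-union ω = mk⇔ (λ ()) λ ()

  P-additive : ∀ {A B C} → IsMeasurable A → IsMeasurable B → (∀ ω → A ω ∧ B ω ≡ false) →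
               (∀ ω → C ω ≡ A ω ∨ B ω) → P C ≡ P A + P B
  P-additive {A} {B} {C} A-m B-m disjoint C≡A∨B = antisym (least bound) (upper (2 , cong (P A +_) (sym (+-identityʳ _))))
    where
    disjoints : PairwiseDisjoint (pair A B)
    disjoints 0             0             i≢j ω = contradiction refl i≢j
    disjoints 0             1             i≢j ω = disjoint ω
    disjoints 1             0             i≢j ω = trans (∧-comm (B ω) (A ω)) (disjoint ω)
    disjoints 1             1             i≢j ω = contradiction refl i≢j
    disjoints i             (suc (suc j)) i≢j ω = ∧-zeroʳ (pair A B i ω)
    disjoints (suc (suc i)) 0             i≢j ω = refl
    disjoints (suc (suc i)) 1             i≢j ω = refl

    supremum = P-σ-additive (pair-measurable A-m B-m) disjoints (pair-union C≡A∨B)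
    upper = proj₁ supremum
    least = proj₂ supremum

    tail : ∀ (f : ℕ → ℕ) k → sum (List.map (P ∘ pair A B) (List.applyUpTo (λ i → suc (suc (f i))) k)) ≡ 0#
    tail f zero    = refl
    tail f (suc k) = trans (cong₂ _+_ P-∅ (tail (f ∘ suc) k)) (+-identityʳ 0#)

    bound : IsUpperBound (λ x → ∃ λ k → x ≡ sum (List.map (P ∘ pair A B) (List.upTo k))) (P A + P B)
    bound (0 , refl)           = +-nonneg (P-nonneg A-m) (P-nonneg B-m)
    bound (1 , refl)           = +-monoʳ-≤ (P A) (P-nonneg B-m)
    bound (suc (suc k) , refl) = ≤-reflexive (cong (P A +_) (trans (cong (P B +_) (tail id k)) (+-identityʳ _)))

  P-split : ∀ {A} → IsMeasurable A → ∀ {B} → IsMeasurable B → P A ≡ P (A ∩ B) + P (A ∖ B)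
  P-split {A} A-m {B} B-m = P-additive (∩-measurable A-m B-m) (∖-measurable A-m B-m)
    (λ ω → disjoint (A ω) (B ω)) (λ ω → cover (A ω) (B ω))
    where
    disjoint : ∀ a b → (a ∧ b) ∧ (a ∧ not b) ≡ false
    disjoint true  true  = refl
    disjoint true  false = refl
    disjoint false b     = refl

    cover : ∀ a b → a ≡ (a ∧ b) ∨ (a ∧ not b)
    cover true  true  = refl
    cover true  false = refl
    cover false b     = refl

  P-cong : ∀ {A B} → IsMeasurable A → (∀ ω → B ω ≡ A ω) → P B ≡ P A
  P-cong {A} A-m B≡A = trans
    (P-additive A-m ∅-measurable (λ ω → ∧-zeroʳ (A ω)) (λ ω → trans (B≡A ω) (sym (∨-identityʳ (A ω)))))
    (trans (cong (P A +_) P-∅) (+-identityʳ _))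

  integralOn : (Ω → Bool) → List Term → ℝ
  integralOn A s = sum (List.map (λ t → coefficient t * P (A ∩ event t)) s)

  integralOn-split : ∀ {A B} → IsMeasurable A → IsMeasurable B → ∀ s →
                     integralOn A s ≡ integralOn (A ∩ B) s + integralOn (A ∖ B) s
  integralOn-split A-m B-m [] = sym (+-identityʳ 0#)
  integralOn-split {A} {B} A-m B-m (t ∷ s) = trans
    (cong₂ _+_ (cong (coefficient t *_) split) (integralOn-split A-m B-m s))
    (solve 5 (λ c x y i j → c :* (x :+ y) :+ (i :+ j) := (c :* x :+ i) :+ (c :* y :+ j)) refl
      (coefficient t) (P ((A ∩ B) ∩ event t)) (P ((A ∖ B) ∩ event t)) _ _)
    where
    reorder : ∀ a b e → (a ∧ b) ∧ e ≡ (a ∧ e) ∧ b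
    reorder true  true  true  = refl
    reorder true  true  false = refl
    reorder true  false true  = refl
    reorder true  false false = refl
    reorder false b     e     = refl

    E-m = ∩-measurable A-m (measurable t)

    split : P (A ∩ event t) ≡ P ((A ∩ B) ∩ event t) + P ((A ∖ B) ∩ event t)
    split = trans (P-split E-m B-m)
      (sym (cong₂ _+_ (P-cong (∩-measurable E-m B-m) λ ω → reorder (A ω) (B ω) (event t ω))
                 (P-cong (∖-measurable E-m B-m) λ ω → reorder (A ω) (not (B ω)) (event t ω))))

  -- Induction on the terms: on the event of the first term the remaining ones are at most `K - c`,
  -- off it at most `K`. Localising to `A` is what lets events that overlap be treated one at a
  -- time.
  integralOn-≤ : ∀ s {A K} → IsMeasurable A → (∀ ω → A ω ≡ true → value s ω ≤ K) →
                 integralOn A s ≤ K * P A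
  integralOn-≤ [] {A} {K} A-m 0≤K with 0# ≤? K
  ... | yes 0≤K = *-nonneg 0≤K (P-nonneg A-m)
  -- A negative `K` forces `A` to be empty, as the value of no terms is 0.
  ... | no  0≰K = ≤-reflexive (sym (trans (cong (K *_) (trans (P-cong ∅-measurable empty) P-∅)) (zeroʳ K)))
    where
    empty : ∀ ω → A ω ≡ false
    empty ω with A ω in Aω
    ... | true  = contradiction (0≤K ω Aω) 0≰K
    ... | false = refl
  integralOn-≤ (t ∷ s) {A} {K} A-m value≤K = begin
    c * P (A ∩ E) + integralOn A s                                        ≡⟨ cong (c * P (A ∩ E) +_) (integralOn-split A-m E-m s) ⟩
    c * P (A ∩ E) + (integralOn (A ∩ E) s + integralOn (A ∖ E) s)
      ≤⟨ +-monoʳ-≤ _ (+-mono-≤ (integralOn-≤ s (∩-measurable A-m E-m) inside)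
                               (integralOn-≤ s (∖-measurable A-m E-m) outside)) ⟩
    c * P (A ∩ E) + ((K - c) * P (A ∩ E) + K * P (A ∖ E))
      ≡⟨ solve 5 (λ c d k p q → c :* p :+ (d :* p :+ k :* q) := (d :+ c) :* p :+ k :* q) refl
           c (K - c) K (P (A ∩ E)) (P (A ∖ E)) ⟩
    (K - c + c) * P (A ∩ E) + K * P (A ∖ E)                               ≡⟨ cong (λ k → k * P (A ∩ E) + K * P (A ∖ E)) (a-b+b≡a K c) ⟩
    K * P (A ∩ E) + K * P (A ∖ E)                                         ≡⟨ distribˡ K _ _ ⟨
    K * (P (A ∩ E) + P (A ∖ E))                                           ≡⟨ cong (K *_) (P-split A-m E-m) ⟨
    K * P A                                                               ∎
    where
    c = coefficient t
    E = event t
    E-m = measurable t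

    inside : ∀ ω → (A ∩ E) ω ≡ true → value s ω ≤ K - c
    inside ω AEω with A ω in Aω | E ω in Eω
    ... | true | true = a+c≤b⇒a≤b-c (subst (_≤ K) (trans (cong (λ b → (if b then c else 0#) + value s ω) Eω) (+-comm c _)) (value≤K ω Aω))

    outside : ∀ ω → (A ∖ E) ω ≡ true → value s ω ≤ K
    outside ω AEω with A ω in Aω | E ω in Eω
    ... | true | false = subst (_≤ K) (trans (cong (λ b → (if b then c else 0#) + value s ω) Eω) (+-identityˡ _)) (value≤K ω Aω)

  integral-≤ : ∀ s {K} → (∀ ω → value s ω ≤ K) → integral s ≤ K
  integral-≤ s {K} value≤K = subst (integral s ≤_) (trans (cong (K *_) P-whole) (*-identityʳ K))
    (integralOn-≤ s whole-measurable (λ ω _ → value≤K ω))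

  -- e is at most the lower integral of F.  F need not be measurable, and no
  -- expectation of F has to exist, so sums of expectations are easy to handle.
  BelowIntegral : (Ω → ℝ) → ℝ → Set
  BelowIntegral F e = ∀ {u} → (∀ s → (∀ ω → value s ω ≤ F ω) → integral s ≤ u) → e ≤ u

  expectation⇒below : ∀ {F e} → IsExpectation F e → BelowIntegral F e
  expectation⇒below (_ , least) bound = least λ { (s , s≤F , refl) → bound s s≤F }

  below-const : ∀ {F e K} → BelowIntegral F e → (∀ ω → F ω ≤ K) → e ≤ K
  below-const below F≤K = below λ s s≤F → integral-≤ s λ ω → ≤-trans (s≤F ω) (F≤K ω)

  below-0 : BelowIntegral (const 0#) 0#
  below-0 bound = bound [] λ _ → ≤-refl

  value-++ : ∀ s s′ ω → value (s ++ s′) ω ≡ value s ω + value s′ ω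
  value-++ s s′ ω = trans (cong sum (List.map-++ _ s s′)) (sum-++ (List.map _ s) _)

  integral-++ : ∀ s s′ → integral (s ++ s′) ≡ integral s + integral s′
  integral-++ s s′ = trans (cong sum (List.map-++ _ s s′)) (sum-++ (List.map _ s) _)

  -- Concatenating simple functions below `F` and `F′` gives one below their sum. The two suprema
  -- are taken one after the other, with the other summand moved across the inequality; only this
  -- superadditive half of linearity is used, so measurability plays no part.
  below-+ : ∀ {F F′ e e′} → BelowIntegral F e → BelowIntegral F′ e′ →
            BelowIntegral (λ ω → F ω + F′ ω) (e + e′)
  below-+ {e = e} {e′} below below′ {u} bound =
    a≤b-c⇒a+c≤b (below λ s s≤F → a+c≤b⇒a≤b-c (subst (_≤ u) (+-comm e′ _)
      (a≤b-c⇒a+c≤b (below′ λ s′ s′≤F′ → a+c≤b⇒a≤b-c (subst (_≤ u)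
        (trans (integral-++ s s′) (+-comm (integral s) _))
        (bound (s ++ s′) λ ω → subst (_≤ _) (sym (value-++ s s′ ω)) (+-mono-≤ (s≤F ω) (s′≤F′ ω))))))))

  halve : Term → Term
  halve t = record
    { coefficient = ½ * coefficient t
    ; nonneg      = *-nonneg 0≤½ (nonneg t)
    ; event       = event t
    ; measurable  = measurable t
    }

  value-halve : ∀ s ω → value (List.map halve s) ω ≡ ½ * value s ω
  value-halve []      ω = sym (zeroʳ ½)
  value-halve (t ∷ s) ω = trans (cong₂ _+_ (half-if (event t ω)) (value-halve s ω)) (sym (distribˡ ½ _ _))
    where
    half-if : ∀ b → (if b then ½ * coefficient t else 0#) ≡ ½ * (if b then coefficient t else 0#)
    half-if true  = refl
    half-if false = sym (zeroʳ ½)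

  integral-halve : ∀ s → integral (List.map halve s) ≡ ½ * integral s
  integral-halve []      = sym (zeroʳ ½)
  integral-halve (t ∷ s) = trans (cong₂ _+_ (*-assoc ½ _ _) (integral-halve s)) (sym (distribˡ ½ _ _))

  below-½ : ∀ {F e} → BelowIntegral F e → BelowIntegral (λ ω → ½ * F ω) (½ * e)
  below-½ {F} {e} below {u} bound = begin
    ½ * e         ≤⟨ *-monoʳ-≤ 0≤½ (below λ s s≤F → begin
      integral s                                       ≡⟨ ½*2x≡x _ ⟨
      ½ * (2# * integral s)
        ≡⟨ solve 2 (λ h i → h :* (nat 2 :* i) := h :* i :+ h :* i) refl ½ (integral s) ⟩
      ½ * integral s + ½ * integral s                  ≡⟨ cong₂ _+_ (integral-halve s) (integral-halve s) ⟨
      integral (List.map halve s) + integral (List.map halve s) ≤⟨ +-mono-≤ (halved s s≤F) (halved s s≤F) ⟩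
      u + u                                            ∎) ⟩
    ½ * (u + u)   ≡⟨ ½*[x+x]≡x u ⟩
    u             ∎
    where
    halved : ∀ s → (∀ ω → value s ω ≤ F ω) → integral (List.map halve s) ≤ u
    halved s s≤F = bound (List.map halve s) λ ω →
      subst (_≤ ½ * F ω) (sym (value-halve s ω)) (*-monoʳ-≤ 0≤½ (s≤F ω))

  below-sum : ∀ {A : Set} {F : A → Ω → ℝ} {e : A → ℝ} → (∀ a → BelowIntegral (F a) (e a)) → ∀ xs →
              BelowIntegral (λ ω → sum (List.map (λ a → F a ω) xs)) (sum (List.map e xs))
  below-sum below []       = below-0
  below-sum below (x ∷ xs) = below-+ (below x) (below-sum below xs)

  -- The exchange of averages in Yao's principle: together with `below-const`, a bound on the
  -- adversary's average against every deterministic strategy bounds the average of the player's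
  -- expected scores.
  below-𝔼 : ∀ {A : Set} {F : A → Ω → ℝ} {e : A → ℝ} → (∀ a → BelowIntegral (F a) (e a)) → ∀ d →
            BelowIntegral (λ ω → 𝔼 d (λ a → F a ω)) (𝔼 d e)
  below-𝔼 below (pure a)   = below a
  below-𝔼 below (flip l r) = below-½ (below-+ (below-𝔼 below l) (below-𝔼 below r))

-- The truncated geometric law: `v < K` has probability 2⁻⁽ᵛ⁺¹⁾, and `K` itself has 2⁻ᴷ.

geo : ℕ → Coins ℕ
geo zero    = pure 0
geo (suc K) = flip (pure 0) (map suc (geo K))

geo-≤ : ∀ K → Support (ℕ._≤ K) (geo K)
geo-≤ zero    = z≤n
geo-≤ (suc K) = z≤n , support-bind (geo K) (geo-≤ K) λ _ → s≤s

iid : ∀ K n → Coins (Vec ℕ n)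
iid K zero    = pure []
iid K (suc n) = geo K >>= λ v → map (v ∷_) (iid K n)

module Geometric (𝓡 : RealNumbers) where
  open RealNumbers 𝓡
  open RealProperties 𝓡
  open CoinExpectation 𝓡
  open ≤-Reasoning

  𝔼-geo-suc : ∀ K f → 𝔼 (geo (suc K)) f ≡ ½ * (f 0 + 𝔼 (geo K) (f ∘ suc))
  𝔼-geo-suc K f = cong (λ e → ½ * (f 0 + e)) (𝔼-map (geo K) suc f)

  geo-mean : ∀ K → 𝔼 (geo K) fromℕ ≤ 1#
  geo-mean zero    = 0≤1
  geo-mean (suc K) = begin
    𝔼 (geo (suc K)) fromℕ                  ≡⟨ 𝔼-geo-suc K fromℕ ⟩
    ½ * (0# + 𝔼 (geo K) (fromℕ ∘ suc))     ≡⟨ cong (½ *_) (+-identityˡ _) ⟩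
    ½ * 𝔼 (geo K) (fromℕ ∘ suc)            ≡⟨ cong (½ *_) (𝔼-+ (geo K) (const 1#) fromℕ) ⟩
    ½ * (𝔼 (geo K) (const 1#) + 𝔼 (geo K) fromℕ)
      ≤⟨ *-monoʳ-≤ 0≤½ (+-mono-≤ (≤-reflexive (𝔼-const 1# (geo K))) (geo-mean K)) ⟩
    ½ * (1# + 1#)                          ≡⟨ ½*[x+x]≡x 1# ⟩
    1#                                     ∎

  private
    0≤1+[θ-1] : ∀ {θ} → 0# ≤ θ → 0# ≤ 1# + (θ - 1#)
    0≤1+[θ-1] {θ} = subst (0# ≤_) (sym (trans (+-comm 1# _) (a-b+b≡a θ 1#)))

    v≰θ : ∀ {θ} → ¬ 0# ≤ θ → ∀ v → ¬ fromℕ v ≤ θ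
    v≰θ 0≰θ v v≤θ = 0≰θ (≤-trans (0≤fromℕ v) v≤θ)

    v≤θ-1⇒1+v≤θ : ∀ {θ} v → fromℕ v ≤ θ - 1# → fromℕ (suc v) ≤ θ
    v≤θ-1⇒1+v≤θ v v≤θ-1 = subst (_≤ _) (+-comm (fromℕ v) 1#) (a≤b-c⇒a+c≤b v≤θ-1)

    1+v≤θ⇒v≤θ-1 : ∀ {θ} v → fromℕ (suc v) ≤ θ → fromℕ v ≤ θ - 1#
    1+v≤θ⇒v≤θ-1 v 1+v≤θ = a+c≤b⇒a≤b-c (subst (_≤ _) (+-comm 1# (fromℕ v)) 1+v≤θ)

  -- Thresholds down to -1 are allowed because the memorylessness step lowers θ by 1.
  geo-excess : ∀ K {θ f} → 0# ≤ 1# + θ →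
               (∀ v → fromℕ v ≤ θ → f v ≤ 2#) →
               (∀ v → ¬ fromℕ v ≤ θ → f v + θ ≤ fromℕ v) →
               𝔼 (geo K) f ≤ 2#
  geo-excess K {θ} {f} 0≤1+θ low high with 0# ≤? θ
  -- For `θ` between -1 and 0 every value passes, and `f v ≤ v - θ ≤ v + 1` has mean at most 2.
  ... | no 0≰θ = begin
    𝔼 (geo K) f                                ≤⟨ 𝔼-monotone (geo K) f≤1+v ⟩
    𝔼 (geo K) (λ v → 1# + fromℕ v)             ≡⟨ 𝔼-+ (geo K) (const 1#) fromℕ ⟩
    𝔼 (geo K) (const 1#) + 𝔼 (geo K) fromℕ
      ≤⟨ +-mono-≤ (≤-reflexive (𝔼-const 1# (geo K))) (≤-trans (geo-mean K) (x≤x+y 1# ≤-refl)) ⟩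
    2#                                         ∎
    where
    f≤1+v : ∀ v → f v ≤ 1# + fromℕ v
    f≤1+v v = begin
      f v               ≤⟨ x≤x+y (f v) 0≤1+θ ⟩
      f v + (1# + θ)    ≡⟨ solve 3 (λ a b c → a :+ (b :+ c) := b :+ (a :+ c)) refl (f v) 1# θ ⟩
      1# + (f v + θ)    ≤⟨ +-monoʳ-≤ 1# (high v (v≰θ 0≰θ v)) ⟩
      1# + fromℕ v      ∎
  geo-excess zero    {θ} {f} 0≤1+θ low high | yes 0≤θ = low 0 0≤θ
  geo-excess (suc K) {θ} {f} 0≤1+θ low high | yes 0≤θ = begin
    𝔼 (geo (suc K)) f                    ≡⟨ 𝔼-geo-suc K f ⟩
    -- Memorylessness: given that the value is positive, lowering both it and `θ` by 1 leaves the
    -- excess unchanged and the law becomes `geo K`.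
    ½ * (f 0 + 𝔼 (geo K) (f ∘ suc))      ≤⟨ *-monoʳ-≤ 0≤½ (+-mono-≤ (low 0 0≤θ) (geo-excess K (0≤1+[θ-1] 0≤θ)
                                              (λ v v≤θ-1 → low (suc v) (v≤θ-1⇒1+v≤θ v v≤θ-1))
                                              high′)) ⟩
    ½ * (2# + 2#)                        ≡⟨ ½*[x+x]≡x 2# ⟩
    2#                                   ∎
    where
    high′ : ∀ v → ¬ fromℕ v ≤ θ - 1# → f (suc v) + (θ - 1#) ≤ fromℕ v
    high′ v v≰θ-1 = subst (_≤ fromℕ v) (+-assoc (f (suc v)) θ (- 1#))
      (a≤b+c⇒a-c≤b (subst (f (suc v) + θ ≤_) (+-comm 1# (fromℕ v)) (high (suc v) (v≰θ-1 ∘ 1+v≤θ⇒v≤θ-1 v))))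

  1+m≤2^m : ∀ m → suc m ℕ.≤ 2 ℕ.^ m
  1+m≤2^m zero    = ℕ.≤-refl
  1+m≤2^m (suc m) = ℕ.+-mono-≤ (ℕ.m^n>0 2 m) (ℕ.≤-trans (1+m≤2^m m) (ℕ.m≤m+n _ 0))

  -- P(v > θ) ≥ 2⁻ᴹ (M - θ), for f ≥ the indicator of v > θ.
  geo-tail : ∀ M {θ f} → 0# ≤ 1# + θ → (∀ v → 0# ≤ f v) →
             (∀ v → ¬ fromℕ v ≤ θ → 1# ≤ f v) →
             fromℕ M ≤ fromℕ (2 ℕ.^ M) * 𝔼 (geo M) f + θ
  geo-tail M {θ} {f} 0≤1+θ 0≤f 1≤f with 0# ≤? θ
  -- Every value passes, so the expectation is at least 1, and `M + 1 ≤ 2ᴹ` leaves room for a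
  -- negative `θ ≥ -1`.
  ... | no 0≰θ = begin
    fromℕ M                             ≤⟨ x≤x+y _ 0≤1+θ ⟩
    fromℕ M + (1# + θ)                  ≡⟨ solve 3 (λ a b c → a :+ (b :+ c) := (b :+ a) :* con 1 :+ c) refl (fromℕ M) 1# θ ⟩
    fromℕ (suc M) * 1# + θ              ≤⟨ +-monoˡ-≤ θ (*-mono-≤ (0≤fromℕ (suc M)) (𝔼-≥ (geo M) 0≤f) (fromℕ-mono-≤ (1+m≤2^m M))
                                            (𝔼-≥ (geo M) λ v → 1≤f v (v≰θ 0≰θ v))) ⟩
    fromℕ (2 ℕ.^ M) * 𝔼 (geo M) f + θ   ∎
  geo-tail zero    {θ} {f} 0≤1+θ 0≤f 1≤f | yes 0≤θ = +-nonneg (*-nonneg (0≤fromℕ 1) (0≤f 0)) 0≤θ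
  geo-tail (suc M) {θ} {f} 0≤1+θ 0≤f 1≤f | yes 0≤θ = begin
    -- `M` and `θ` both drop by 1. The coin separating 0 from the positive values costs a factor ½,
    -- which the additional factor 2 in the power makes up for.
    1# + fromℕ M                           ≤⟨ +-monoʳ-≤ 1# (geo-tail M (0≤1+[θ-1] 0≤θ) (0≤f ∘ suc)
                                                 (λ v v≰θ-1 → 1≤f (suc v) (v≰θ-1 ∘ 1+v≤θ⇒v≤θ-1 v))) ⟩
    1# + (N * e + (θ - 1#))                ≡⟨ solve 3 (λ a b c → a :+ (b :+ c) := b :+ (c :+ a)) refl 1# (N * e) (θ - 1#) ⟩
    N * e + (θ - 1# + 1#)                  ≡⟨ cong (N * e +_) (a-b+b≡a θ 1#) ⟩
    N * e + θ                              ≤⟨ +-monoˡ-≤ θ (*-monoʳ-≤ (0≤fromℕ (2 ℕ.^ M)) (x≤y+x (0≤f 0))) ⟩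
    N * (f 0 + e) + θ                      ≡⟨ cong (_+ θ) (½*2x≡x _) ⟨
    ½ * (2# * (N * (f 0 + e))) + θ         ≡⟨ cong (_+ θ) (solve 4 (λ h t n x → h :* (t :* (n :* x)) := (t :* n) :* (h :* x)) refl ½ 2# N (f 0 + e)) ⟩
    (2# * N) * (½ * (f 0 + e)) + θ         ≡⟨ cong (_+ θ) (cong₂ _*_ (fromℕ-homo-* 2 (2 ℕ.^ M)) (𝔼-geo-suc M f)) ⟨
    fromℕ (2 ℕ.^ suc M) * 𝔼 (geo (suc M)) f + θ  ∎
    where
    N = fromℕ (2 ℕ.^ M)
    e = 𝔼 (geo M) (f ∘ suc)

  𝔼-iid-suc : ∀ K n f → 𝔼 (iid K (suc n)) f ≡ 𝔼 (geo K) (λ v → 𝔼 (iid K n) (λ b → f (v ∷ b)))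
  𝔼-iid-suc K n f = trans (𝔼-bind (geo K) _ f) (𝔼-ext (geo K) λ v → 𝔼-map (iid K n) (v ∷_) f)

  -- Independence and exchangeability: whichever option a random order puts first, its value is a
  -- fresh draw and the others are still iid.
  iid-removeAt : ∀ K n (j : Fin (suc n)) (f : ℕ → Vec ℕ n → ℝ) →
                 𝔼 (iid K (suc n)) (λ b → f (lookup b j) (removeAt b j)) ≡
                 𝔼 (geo K) (λ v → 𝔼 (iid K n) (f v))
  iid-removeAt K n       zero    f = 𝔼-iid-suc K n (λ b → f (lookup b zero) (removeAt b zero))
  iid-removeAt K (suc n) (suc j) f = begin-equality
    𝔼 (iid K (2 ℕ.+ n)) (λ b → f (lookup b (suc j)) (removeAt b (suc j)))
      ≡⟨ 𝔼-iid-suc K (suc n) (λ b → f (lookup b (suc j)) (removeAt b (suc j))) ⟩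
    𝔼 (geo K) (λ v → 𝔼 (iid K (suc n)) (λ b → f (lookup b j) (removeAt (v ∷ b) (suc j))))
      ≡⟨ 𝔼-ext (geo K) (λ v → 𝔼-ext (iid K (suc n)) λ b → cong (f (lookup b j)) (removeAt-∷ v b j)) ⟩
    𝔼 (geo K) (λ v → 𝔼 (iid K (suc n)) (λ b → f (lookup b j) (v ∷ removeAt b j)))
      ≡⟨ 𝔼-ext (geo K) (λ v → iid-removeAt K n j (λ w b → f w (v ∷ b))) ⟩
    𝔼 (geo K) (λ v → 𝔼 (geo K) (λ w → 𝔼 (iid K n) (λ b → f w (v ∷ b))))
      ≡⟨ 𝔼-swap (geo K) (geo K) _ ⟩
    𝔼 (geo K) (λ w → 𝔼 (geo K) (λ v → 𝔼 (iid K n) (λ b → f w (v ∷ b))))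
      ≡⟨ 𝔼-ext (geo K) (λ w → 𝔼-iid-suc K n (f w)) ⟨
    𝔼 (geo K) (λ w → 𝔼 (iid K (suc n)) (f w)) ∎
    where
    removeAt-∷ : ∀ {n} v (b : Vec ℕ (suc n)) j → removeAt (v ∷ b) (suc j) ≡ v ∷ removeAt b j
    removeAt-∷ v (_ ∷ _) j = refl

-- A single test against a geometric value.

module Game (𝓡 : RealNumbers) where
  open RealNumbers 𝓡
  open RealProperties 𝓡
  open CoinExpectation 𝓡
  open Geometric 𝓡
  open Strategy
  open ≤-Reasoning

  values : ∀ {n} → Vec ℕ n → Vec ℝ n
  values = Vec.map fromℕ

  data TestCase (θ : ℝ) (0≤θ : 0# ≤ θ) (x : ℝ) : Set where
    low  : x ≤ θ → remainingUtility 𝓡 (finite θ 0≤θ) x ≡ 0# → TestCase θ 0≤θ x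
    high : ¬ x ≤ θ → test 𝓡 (finite θ 0≤θ) x ≡ passed →
           remainingUtility 𝓡 (finite θ 0≤θ) x + θ ≡ x → TestCase θ 0≤θ x

  testCase : ∀ θ 0≤θ x → TestCase θ 0≤θ x
  testCase θ 0≤θ x with x ≤? θ in eq
  ... | yes x≤θ = low x≤θ (x≤y⇒x⊔y≈y (a≤b+c⇒a-c≤b (subst (x ≤_) (sym (+-identityˡ θ)) x≤θ)))
  ... | no  x≰θ = high x≰θ (cong (λ d → if ⌊ d ⌋ then failed x else passed) eq)
    (trans (cong (_+ θ) (antisym (⊔-lub ≤-refl (a+c≤b⇒a≤b-c (subst (_≤ x) (sym (+-identityˡ θ)) (≰⇒≥ x≰θ))))
                                 (x≤x⊔y _ _)))
      (a-b+b≡a x θ))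

  if-≤ : ∀ b {x y z : ℝ} → x ≤ z → y ≤ z → (if b then x else y) ≤ z
  if-≤ true  x≤z y≤z = x≤z
  if-≤ false x≤z y≤z = y≤z

  ≤-if : ∀ b {x y z : ℝ} → z ≤ x → z ≤ y → z ≤ (if b then x else y)
  ≤-if true  z≤x z≤y = z≤x
  ≤-if false z≤x z≤y = z≤y

  module _ (t : Threshold 𝓡) (stop : Outcome 𝓡 → Bool) where

    stop? : ℕ → Bool
    stop? v = stop (test 𝓡 t (fromℕ v))

    gain : ℕ → ℝ
    gain v = remainingUtility 𝓡 t (fromℕ v)

  -- Replacing the gain by 2 off the stopping event says that the mean gain
  -- on it is at most twice its probability.
  stop-excess : ∀ K t stop → 𝔼 (geo K) (λ v → if stop? t stop v then gain t stop v else 2#) ≤ 2#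
  stop-excess K ∞              stop = 𝔼-≤ (geo K) λ v → if-≤ (stop? ∞ stop v) 0≤2 ≤-refl
  -- A passed test reveals nothing more, so the single decision `stop passed` serves all values
  -- above `θ`, while a failed test has gain 0.
  stop-excess K t@(finite θ 0≤θ) stop with stop passed in eq
  ... | true  = geo-excess K (+-nonneg 0≤1 0≤θ) below above
    where
    below : ∀ v → fromℕ v ≤ θ → (if stop? t stop v then gain t stop v else 2#) ≤ 2#
    below v v≤θ with testCase θ 0≤θ (fromℕ v)
    ... | low _ gain≡0   = if-≤ (stop? t stop v) (subst (_≤ 2#) (sym gain≡0) 0≤2) ≤-refl
    ... | high v≰θ _ _   = contradiction v≤θ v≰θ

    above : ∀ v → ¬ fromℕ v ≤ θ → (if stop? t stop v then gain t stop v else 2#) + θ ≤ fromℕ v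
    above v v≰θ with testCase θ 0≤θ (fromℕ v)
    ... | low v≤θ _        = contradiction v≤θ v≰θ
    ... | high _ pass gain+θ≡v = ≤-reflexive
      (trans (cong (λ b → (if b then gain t stop v else 2#) + θ) (trans (cong stop pass) eq)) gain+θ≡v)
  ... | false = 𝔼-≤ (geo K) bound
    where
    bound : ∀ v → (if stop? t stop v then gain t stop v else 2#) ≤ 2#
    bound v with testCase θ 0≤θ (fromℕ v)
    ... | low _ gain≡0   = if-≤ (stop? t stop v) (subst (_≤ 2#) (sym gain≡0) 0≤2) ≤-refl
    ... | high _ pass _  = ≤-reflexive (cong (λ b → if b then gain t stop v else 2#) (trans (cong stop pass) eq))

  -- A positive gain `M - θ` is collected only by a player that accepts after `passed`, and such a
  -- player also stops at every iid value above `θ`; `geo-tail` bounds that probability from below.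
  -- The 2 on the left stands for the value of continuing on iid options.
  stop-tail : ∀ M t stop → (if stop? t stop M then gain t stop M else 2#) ≤
              2# + fromℕ (2 ℕ.^ M) * 𝔼 (geo M) (λ v → if stop? t stop v then 1# else 0#)
  stop-tail M t stop = go t
    where
    Q : Threshold 𝓡 → ℝ
    Q t = fromℕ (2 ℕ.^ M) * 𝔼 (geo M) (λ v → if stop? t stop v then 1# else 0#)

    0≤indicator : ∀ t v → 0# ≤ (if stop? t stop v then 1# else 0#)
    0≤indicator t v = ≤-if (stop? t stop v) 0≤1 ≤-refl

    0≤Q : ∀ t → 0# ≤ Q t
    0≤Q t = *-nonneg (0≤fromℕ (2 ℕ.^ M)) (𝔼-≥ (geo M) (0≤indicator t))

    go : ∀ t → (if stop? t stop M then gain t stop M else 2#) ≤ 2# + Q t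
    go ∞ = if-≤ (stop? ∞ stop M) (+-nonneg 0≤2 (0≤Q ∞)) (x≤x+y 2# (0≤Q ∞))
    go t@(finite θ 0≤θ) with testCase θ 0≤θ (fromℕ M)
    ... | low _ gain≡0 = if-≤ (stop? t stop M)
      (subst (_≤ 2# + Q t) (sym gain≡0) (+-nonneg 0≤2 (0≤Q t))) (x≤x+y 2# (0≤Q t))
    ... | high _ pass gain+θ≡M rewrite pass with stop passed in eq
    ...   | false = x≤x+y 2# (0≤Q t)
    ...   | true  = ≤-trans
      (subst (_≤ Q t) (a+b-b≡a _ θ) (subst (λ m → m - θ ≤ Q t) (sym gain+θ≡M)
        (a≤b+c⇒a-c≤b (geo-tail M (+-nonneg 0≤1 0≤θ) (0≤indicator t) above))))
      (x≤y+x 0≤2)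
      where
      above : ∀ v → ¬ fromℕ v ≤ θ → 1# ≤ (if stop? t stop v then 1# else 0#)
      above v v≰θ with testCase θ 0≤θ (fromℕ v)
      ... | low v≤θ _     = contradiction v≤θ v≰θ
      ... | high _ pass _ = ≤-reflexive (sym (cong (λ b → if b then 1# else 0#) (trans (cong stop pass) eq)))

  -- Sums over all permutations.

  lookup-punchIn : ∀ {A : Set} {n} (a : Vec A (suc n)) j i → lookup a (punchIn j i) ≡ lookup (removeAt a j) i
  lookup-punchIn (x ∷ xs)     zero    i       = refl
  lookup-punchIn (x ∷ y ∷ xs) (suc j) zero    = refl
  lookup-punchIn (x ∷ y ∷ xs) (suc j) (suc i) = lookup-punchIn (y ∷ xs) j i

  -- This matches the recursive listing of permutations with the recursion of `play`: option `j`
  -- arrives first, then the others in the order `ρ`.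
  permute-insert : ∀ {n} (a : Vec ℕ (suc n)) j ρ →
                   permute 𝓡 (Perm.insert zero j ρ) (values a) ≡
                   fromℕ (lookup a j) ∷ permute 𝓡 ρ (values (removeAt a j))
  permute-insert a j ρ = cong₂ _∷_ (Vec.lookup-map j fromℕ a) (Vec.tabulate-cong λ i → begin-equality
    lookup (values a) (Perm.insert zero j ρ ⟨$⟩ʳ suc i)  ≡⟨ cong (lookup (values a)) (Perm.insert-punchIn zero j ρ i) ⟩
    lookup (values a) (punchIn j (ρ ⟨$⟩ʳ i))             ≡⟨ Vec.lookup-map (punchIn j (ρ ⟨$⟩ʳ i)) fromℕ a ⟩
    fromℕ (lookup a (punchIn j (ρ ⟨$⟩ʳ i)))              ≡⟨ cong fromℕ (lookup-punchIn a j (ρ ⟨$⟩ʳ i)) ⟩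
    fromℕ (lookup (removeAt a j) (ρ ⟨$⟩ʳ i))             ≡⟨ Vec.lookup-map (ρ ⟨$⟩ʳ i) fromℕ (removeAt a j) ⟨
    lookup (values (removeAt a j)) (ρ ⟨$⟩ʳ i)            ∎)

  permutationSum : ∀ n → (Permutation′ n → ℝ) → ℝ
  permutationSum n F = sum (List.map F (permutations n))

  permutationSum-const : ∀ n c → permutationSum n (const c) ≡ fromℕ (n !) * c
  permutationSum-const n c = trans (sum-map-const c (permutations n))
    (cong (λ l → fromℕ l * c) (permutations-length n))

  sum-allFin-suc : ∀ n (f : Fin (suc n) → ℝ) →
                   sum (List.map f (allFin (suc n))) ≡ f zero + sum (List.map (f ∘ suc) (allFin n))
  sum-allFin-suc n f = cong (λ l → f zero + sum l)
    (trans (List.map-tabulate suc f) (sym (List.map-tabulate id (f ∘ suc))))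

  sum-allFin-≤ : ∀ n {f : Fin n → ℝ} {c} → (∀ j → f j ≤ c) → sum (List.map f (allFin n)) ≤ fromℕ n * c
  sum-allFin-≤ n {f} {c} f≤c = subst (sum (List.map f (allFin n)) ≤_)
    (trans (sum-map-const c (allFin n)) (cong (λ l → fromℕ l * c) (List.length-tabulate {n = n} id)))
    (sum-map-≤ f≤c (allFin n))

  -- Random order: a value hidden among iid draws.

  module _ (s : Strategy 𝓡) where

    stops : History 𝓡 → ℕ → Bool
    stops h = stop? (threshold s h) (accept s h)

    gains : History 𝓡 → ℕ → ℝ
    gains h = gain (threshold s h) (accept s h)

    next : History 𝓡 → ℕ → History 𝓡
    next h v = test 𝓡 (threshold s h) (fromℕ v) ∷ h

    -- This is `n !` times the mean score in random order; keeping the factorial avoids division in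
    -- the inductions.
    totalScore : ∀ {X : Set} {n} → Coins X → (X → Vec ℕ n) → History 𝓡 → ℝ
    totalScore {n = n} d a h = 𝔼 d λ x → permutationSum n λ ρ → play 𝓡 s h (permute 𝓡 ρ (values (a x)))

    firstDraw : ∀ {X : Set} {n} → Coins X → (X → Vec ℕ n) → History 𝓡 → ℕ → ℝ
    firstDraw {n = n} d a h v =
      𝔼 d λ x → permutationSum n λ ρ → play 𝓡 s h (fromℕ v ∷ permute 𝓡 ρ (values (a x)))

    firstDraw-≡ : ∀ {X : Set} {n} (d : Coins X) (a : X → Vec ℕ n) h v →
                  firstDraw d a h v ≡ (if stops h v then fromℕ (n !) * gains h v else totalScore d a (next h v))
    firstDraw-≡ {n = n} d a h v with stops h v
    ... | true  = trans (𝔼-ext d λ _ → permutationSum-const n (gains h v)) (𝔼-const _ d)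
    ... | false = refl

    totalScore-suc : ∀ {X : Set} {n} (d : Coins X) (a : X → Vec ℕ (suc n)) h →
                totalScore d a h ≡ sum (List.map (λ j → 𝔼 d λ x → permutationSum n λ ρ →
                  play 𝓡 s h (fromℕ (lookup (a x) j) ∷ permute 𝓡 ρ (values (removeAt (a x) j)))) (allFin (suc n)))
    totalScore-suc {n = n} d a h = trans
      (𝔼-ext d λ x → trans (sum-cartesianProductWith (Perm.insert zero) _ (allFin (suc n)) (permutations n))
        (sum-map-cong (λ j → sum-map-cong (λ ρ → cong (play 𝓡 s h) (permute-insert (a x) j ρ)) (permutations n))
          (allFin (suc n))))
      (𝔼-sum d _ (allFin (suc n)))

    -- The option that comes first is a fresh draw, independent of the rest. Continuing is worth at
    -- most 2 by induction, so `stop-excess` bounds the choice between stopping and continuing by 2.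
    iid-total-≤ : ∀ K n h → totalScore (iid K n) id h ≤ fromℕ (n !) * 2#
    iid-total-≤ K zero    h = subst (_≤ fromℕ 1 * 2#) (sym (+-identityʳ 0#)) (*-nonneg (0≤fromℕ 1) 0≤2)
    iid-total-≤ K (suc n) h = begin
      totalScore (iid K (suc n)) id h                 ≡⟨ totalScore-suc (iid K (suc n)) id h ⟩
      sum (List.map _ (allFin (suc n)))          ≤⟨ sum-allFin-≤ (suc n) draw ⟩
      fromℕ (suc n) * (fromℕ (n !) * 2#)         ≡⟨ *-assoc _ _ _ ⟨
      fromℕ (suc n) * fromℕ (n !) * 2#           ≡⟨ cong (_* 2#) (fromℕ-homo-* (suc n) (n !)) ⟨
      fromℕ (suc n !) * 2#                       ∎
      where
      after : ∀ v → firstDraw (iid K n) id h v ≤ fromℕ (n !) * (if stops h v then gains h v else 2#)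
      after v rewrite firstDraw-≡ (iid K n) id h v with stops h v
      ... | true  = ≤-refl
      ... | false = iid-total-≤ K n (next h v)

      draw : ∀ j → 𝔼 (iid K (suc n)) (λ b → permutationSum n λ ρ →
               play 𝓡 s h (fromℕ (lookup b j) ∷ permute 𝓡 ρ (values (removeAt b j)))) ≤ fromℕ (n !) * 2#
      draw j = begin
        _                                        ≡⟨ iid-removeAt K n j (λ v b → permutationSum n λ ρ →
                                                      play 𝓡 s h (fromℕ v ∷ permute 𝓡 ρ (values b))) ⟩
        𝔼 (geo K) (firstDraw (iid K n) id h)     ≤⟨ 𝔼-monotone (geo K) after ⟩
        𝔼 (geo K) (λ v → fromℕ (n !) * (if stops h v then gains h v else 2#))
                                                 ≡⟨ 𝔼-* (geo K) (fromℕ (n !)) _ ⟩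
        fromℕ (n !) * 𝔼 (geo K) (λ v → if stops h v then gains h v else 2#)
          ≤⟨ *-monoʳ-≤ (0≤fromℕ (n !)) (stop-excess K (threshold s h) (accept s h)) ⟩
        fromℕ (n !) * 2#                         ∎

    stopProbability : ℕ → ℕ → History 𝓡 → ℝ
    stopProbability K zero    h = 0#
    stopProbability K (suc n) h = 𝔼 (geo K) λ v → if stops h v then 1# else stopProbability K n (next h v)

    stopProbability-nonneg : ∀ K n h → 0# ≤ stopProbability K n h
    stopProbability-nonneg K zero    h = ≤-refl
    stopProbability-nonneg K (suc n) h = 𝔼-≥ (geo K) λ v →
      ≤-if (stops h v) 0≤1 (stopProbability-nonneg K n (next h v))

    stopProbability-≤1 : ∀ K n h → stopProbability K n h ≤ 1#
    stopProbability-≤1 K zero    h = 0≤1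
    stopProbability-≤1 K (suc n) h = 𝔼-≤ (geo K) λ v →
      if-≤ (stops h v) ≤-refl (stopProbability-≤1 K n (next h v))

    -- The option M hidden among n iid options sits at each of the n + 1
    -- positions equally often, and until it is met the player sees the iid
    -- world.  Catching it with gain M - θ requires a threshold θ at which the
    -- iid world stops with probability at least 2⁻ᴹ (M - θ).
    hidden-total-≤ : ∀ M n h → totalScore (iid M n) (M ∷_) h ≤
      fromℕ (n !) * (fromℕ (suc n) * 2# + fromℕ (2 ℕ.^ M) * stopProbability M (suc n) h)
    hidden-total-≤ M n h = begin
      totalScore (iid M n) (M ∷_) h                      ≡⟨ totalScore-suc (iid M n) (M ∷_) h ⟩
      sum (List.map term (allFin (suc n)))          ≡⟨ sum-allFin-suc n term ⟩
      -- Either the hidden option comes first and leaves a purely iid rest, or one of the `n` iid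
      -- options does.
      firstDraw (iid M n) id h M + rest             ≤⟨ +-mono-≤ hiddenFirst restBound ⟩
      fromℕ (n !) * (2# + N * q) + fromℕ (n !) * (fromℕ n * 2# + N * r)
        ≡⟨ solve 6 (λ f t n q m r → f :* (t :+ n :* q) :+ f :* (m :* t :+ n :* r) :=
                                   f :* ((con 1 :+ m) :* t :+ n :* (q :+ r))) refl
             (fromℕ (n !)) 2# N q (fromℕ n) r ⟩
      fromℕ (n !) * (fromℕ (suc n) * 2# + N * (q + r))
        ≡⟨ cong (λ e → fromℕ (n !) * (fromℕ (suc n) * 2# + N * e)) q+r≡p ⟩
      fromℕ (n !) * (fromℕ (suc n) * 2# + N * stopProbability M (suc n) h) ∎
      where
      N = fromℕ (2 ℕ.^ M)
      -- In a purely iid sequence, `q` is the probability of stopping at the next draw and `r` that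
      -- of stopping at a later one.
      q = 𝔼 (geo M) λ v → if stops h v then 1# else 0#
      r = 𝔼 (geo M) λ v → if stops h v then 0# else stopProbability M n (next h v)

      term : Fin (suc n) → ℝ
      term j = 𝔼 (iid M n) λ b → permutationSum n λ ρ →
        play 𝓡 s h (fromℕ (lookup (M ∷ b) j) ∷ permute 𝓡 ρ (values (removeAt (M ∷ b) j)))

      rest = sum (List.map (term ∘ suc) (allFin n))

      q+r≡p : q + r ≡ stopProbability M (suc n) h
      q+r≡p = trans (sym (𝔼-+ (geo M) _ _)) (𝔼-ext (geo M) λ v → split (stops h v))
        where
        split : ∀ b {x} → (if b then 1# else 0#) + (if b then 0# else x) ≡ (if b then 1# else x)
        split true  = +-identityʳ 1#
        split false = +-identityˡ _

      hiddenFirst : firstDraw (iid M n) id h M ≤ fromℕ (n !) * (2# + N * q)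
      hiddenFirst = ≤-trans after (*-monoʳ-≤ (0≤fromℕ (n !)) (stop-tail M (threshold s h) (accept s h)))
        where
        after : firstDraw (iid M n) id h M ≤ fromℕ (n !) * (if stops h M then gains h M else 2#)
        after rewrite firstDraw-≡ (iid M n) id h M with stops h M
        ... | true  = ≤-refl
        ... | false = iid-total-≤ M n (next h M)

      restBound : rest ≤ fromℕ (n !) * (fromℕ n * 2# + N * r)
      restBound = go n refl
        where
        go : ∀ m → m ≡ n → rest ≤ fromℕ (n !) * (fromℕ n * 2# + N * r)
        go zero    refl = *-nonneg (0≤fromℕ 1) (+-nonneg (*-nonneg ≤-refl 0≤2)
          (*-nonneg (0≤fromℕ (2 ℕ.^ M)) (𝔼-≥ (geo M) λ v →
            ≤-if (stops h v) ≤-refl (stopProbability-nonneg M n (next h v)))))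
        -- Whichever of the `n` iid options comes first is a fresh draw and leaves `M` hidden among
        -- `m` others, so all `n` choices contribute the same amount and the induction applies.
        go (suc m) refl = begin
          rest                                                    ≤⟨ sum-allFin-≤ n draw ⟩
          fromℕ n * 𝔼 (geo M) (firstDraw (iid M m) (M ∷_) h)      ≡⟨ 𝔼-* (geo M) (fromℕ n) _ ⟨
          𝔼 (geo M) (λ v → fromℕ n * firstDraw (iid M m) (M ∷_) h v)
            ≤⟨ 𝔼-monotone (geo M) after ⟩
          𝔼 (geo M) (λ v → fromℕ (n !) * (fromℕ n * A v + N * B v)) ≡⟨ 𝔼-* (geo M) (fromℕ (n !)) _ ⟩
          fromℕ (n !) * 𝔼 (geo M) (λ v → fromℕ n * A v + N * B v)
            ≡⟨ cong (fromℕ (n !) *_) (trans (𝔼-+ (geo M) _ _) (cong₂ _+_ (𝔼-* (geo M) _ A) (𝔼-* (geo M) N B))) ⟩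
          fromℕ (n !) * (fromℕ n * 𝔼 (geo M) A + N * r)
            ≤⟨ *-monoʳ-≤ (0≤fromℕ (n !)) (+-monoˡ-≤ (N * r) (*-monoʳ-≤ (0≤fromℕ n)
                 (stop-excess M (threshold s h) (accept s h)))) ⟩
          fromℕ (n !) * (fromℕ n * 2# + N * r)                    ∎
          where
          A B : ℕ → ℝ
          A v = if stops h v then gains h v else 2#
          B v = if stops h v then 0# else stopProbability M n (next h v)

          draw : ∀ j → term (suc j) ≤ 𝔼 (geo M) (firstDraw (iid M m) (M ∷_) h)
          draw j = ≤-reflexive (trans
            -- Exposing the head of `b` lets `removeAt (M ∷ b) (suc j)` reduce to
            -- `M ∷ removeAt b j`.
            (𝔼-ext (iid M (suc m)) λ { b@(_ ∷ _) → refl })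
            (iid-removeAt M m j λ v b → permutationSum n λ ρ →
              play 𝓡 s h (fromℕ v ∷ permute 𝓡 ρ (values (M ∷ b)))))

          after : ∀ v → fromℕ n * firstDraw (iid M m) (M ∷_) h v ≤ fromℕ (n !) * (fromℕ n * A v + N * B v)
          after v rewrite firstDraw-≡ (iid M m) (M ∷_) h v with stops h v
          ... | true  = ≤-reflexive (solve 4 (λ n f g k → n :* (f :* g) := f :* (n :* g :+ k :* con 0)) refl
                          (fromℕ n) (fromℕ (n !)) (gains h v) N)
          ... | false = begin
            fromℕ n * totalScore (iid M m) (M ∷_) (next h v)
              ≤⟨ *-monoʳ-≤ (0≤fromℕ n) (hidden-total-≤ M m (next h v)) ⟩
            fromℕ n * (fromℕ (m !) * (fromℕ n * 2# + N * stopProbability M n (next h v)))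
              ≡⟨ *-assoc _ _ _ ⟨
            fromℕ n * fromℕ (m !) * (fromℕ n * 2# + N * stopProbability M n (next h v))
              ≡⟨ cong (_* (fromℕ n * 2# + N * stopProbability M n (next h v))) (fromℕ-homo-* n (m !)) ⟨
            fromℕ (n !) * (fromℕ n * 2# + N * stopProbability M n (next h v)) ∎

    -- A stopping probability is at most 1, so averaged over the `n + 1` positions the hidden option
    -- adds at most 2ᴹ / (n + 1) ≤ 1 to the 2 of the iid world.
    hidden-total-≤3 : ∀ M n h → 2 ℕ.^ M ℕ.≤ suc n → totalScore (iid M n) (M ∷_) h ≤ fromℕ (suc n !) * 3#
    hidden-total-≤3 M n h 2^M≤1+n = begin
      totalScore (iid M n) (M ∷_) h  ≤⟨ hidden-total-≤ M n h ⟩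
      fromℕ (n !) * (fromℕ (suc n) * 2# + fromℕ (2 ℕ.^ M) * stopProbability M (suc n) h)
        ≤⟨ *-monoʳ-≤ (0≤fromℕ (n !)) (+-monoʳ-≤ _ (*-mono-≤ (0≤fromℕ (2 ℕ.^ M)) 0≤1
             (fromℕ-mono-≤ 2^M≤1+n) (stopProbability-≤1 M (suc n) h))) ⟩
      fromℕ (n !) * (fromℕ (suc n) * 2# + fromℕ (suc n) * 1#)
        ≡⟨ solve 2 (λ f m → f :* (m :* nat 2 :+ m :* con 1) := (m :* f) :* nat 3) refl (fromℕ (n !)) (fromℕ (suc n)) ⟩
      fromℕ (suc n) * fromℕ (n !) * 3#  ≡⟨ cong (_* 3#) (fromℕ-homo-* (suc n) (n !)) ⟨
      fromℕ (suc n !) * 3#              ∎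

-- Arbitrary order: the adversary's draws from stock.

data Supply (K : ℕ) {n : ℕ} (a : Vec ℕ n) : Set where
  exhausted : ¬ suc K ∈ a → Supply K a
  gap       : ∀ k → k ℕ.< suc K → ¬ k ∈ a → Supply K a
  stocked   : (∀ k → k ℕ.≤ suc K → k ∈ a) → Supply K a

-- The cases overlap, and `exhausted` takes precedence: a missing top value only shrinks the range,
-- so the adversary gives up only if a lower level runs out while the top one is still in stock.
supply : ∀ K {n} (a : Vec ℕ n) → Supply K a
supply K a with suc K ∈? a | ℕ.anyUpTo? (λ k → ¬? (k ∈? a)) (suc K)
... | no  K∉a | _                      = exhausted K∉a
... | yes K∈a | yes (k , k<1+K , k∉a)  = gap k k<1+K k∉a
... | yes K∈a | no none                = stocked member
  where
  member : ∀ k → k ℕ.≤ suc K → k ∈ a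
  member k k≤1+K with ℕ.m≤n⇒m<n∨m≡n k≤1+K
  ... | inj₂ refl  = K∈a
  ... | inj₁ k<1+K = decidable-stable (k ∈? a) λ k∉a → none (k , k<1+K , k∉a)

-- The position of some occurrence of v, or junk if there is none.
find : ∀ {n} → Vec ℕ (suc n) → ℕ → Fin (suc n)
find a v with v ∈? a
... | yes v∈a = Any.index v∈a
... | no  _   = zero

lookup-find : ∀ {n} (a : Vec ℕ (suc n)) {v} → v ∈ a → lookup a (find a v) ≡ v
lookup-find a {v} v∈a with v ∈? a
... | yes v∈a′ = sym (Any.lookup-index v∈a′)
... | no  v∉a  = contradiction v∈a v∉a

All-removeAt : ∀ {P : ℕ → Set} {n} {a : Vec ℕ (suc n)} → All P a → ∀ j → All P (removeAt a j)
All-removeAt (p ∷ ps)      zero    = ps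
All-removeAt (p ∷ q ∷ ps)  (suc j) = p ∷ All-removeAt (q ∷ ps) j

All-replicate : ∀ {P : ℕ → Set} {x} → P x → ∀ n → All P (Vec.replicate n x)
All-replicate p zero    = []
All-replicate p (suc n) = p ∷ All-replicate p n

-- The adversary's random order: values are drawn from geo as long as all of
-- them are in stock, with the range shrinking when its top value runs out.
-- If another value runs out first, the adversary gives up.
order : ∀ (K : ℕ) {n} → Vec ℕ n → Coins (Permutation′ n)
order zero    a            = pure Perm.id
order (suc K) {zero}  a    = pure Perm.id
order (suc K) {suc n} a with supply K a
... | exhausted _ = order K a
... | gap _ _ _   = pure Perm.id
... | stocked _   = geo (suc K) >>= λ v →
  map (Perm.insert zero (find a v)) (order (suc K) (removeAt a (find a v)))

-- The martingale that controls premature exhaustion of a level.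

module Potential (𝓡 : RealNumbers) where
  open RealNumbers 𝓡
  open RealProperties 𝓡
  open CoinExpectation 𝓡
  open Geometric 𝓡
  open ≤-Reasoning

  ⅔ : ℝ
  ⅔ = (1# + ½) ⁻¹

  1+½≢0 : 1# + ½ ≢ 0#
  1+½≢0 eq = 0≢1 (antisym 0≤1 (subst (1# ≤_) eq (x≤x+y 1# 0≤½)))

  0≤⅔ : 0# ≤ ⅔
  0≤⅔ = ⁻¹-nonneg (+-nonneg 0≤1 0≤½) 1+½≢0

  ⅔*[1+½]≡1 : ⅔ * (1# + ½) ≡ 1#
  ⅔*[1+½]≡1 = trans (*-comm ⅔ _) (*-inverseʳ 1+½≢0)

  ⅔≤1 : ⅔ ≤ 1#
  ⅔≤1 = begin
    ⅔              ≡⟨ *-identityʳ ⅔ ⟨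
    ⅔ * 1#         ≤⟨ *-monoʳ-≤ 0≤⅔ (x≤x+y 1# 0≤½) ⟩
    ⅔ * (1# + ½)   ≡⟨ ⅔*[1+½]≡1 ⟩
    1#             ∎

  ⅔²*2≤1 : ⅔ * ⅔ * 2# ≤ 1#
  ⅔²*2≤1 = begin
    ⅔ * ⅔ * 2#                              ≤⟨ *-monoʳ-≤ (*-nonneg 0≤⅔ 0≤⅔) 2≤[1+½]² ⟩
    ⅔ * ⅔ * ((1# + ½) * (1# + ½))           ≡⟨ solve 2 (λ x y → (x :* x) :* (y :* y) := (x :* y) :* (x :* y)) refl ⅔ (1# + ½) ⟩
    (⅔ * (1# + ½)) * (⅔ * (1# + ½))         ≡⟨ cong₂ _*_ ⅔*[1+½]≡1 ⅔*[1+½]≡1 ⟩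
    1# * 1#                                 ≡⟨ *-identityʳ 1# ⟩
    1#                                      ∎
    where
    2≤[1+½]² : 2# ≤ (1# + ½) * (1# + ½)
    2≤[1+½]² = begin
      2#                          ≡⟨ cong (1# +_) (trans (+-identityʳ 1#) (sym ½+½≡1)) ⟩
      1# + (½ + ½)                ≤⟨ x≤x+y _ (*-nonneg 0≤½ 0≤½) ⟩
      1# + (½ + ½) + ½ * ½        ≡⟨ solve 1 (λ h → con 1 :+ (h :+ h) :+ h :* h := (con 1 :+ h) :* (con 1 :+ h)) refl ½ ⟩
      (1# + ½) * (1# + ½)         ∎

  -- An option `v` contributes the factor ⅔ to the potential of level `k` if `v = k`, 2 if `v > k`,
  -- and 1 if `v < k`. Its removal multiplies the potential by the reciprocal.
  weight inverseWeight : ℕ → ℕ → ℝ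
  weight zero    zero    = ⅔
  weight zero    (suc v) = 2#
  weight (suc k) zero    = 1#
  weight (suc k) (suc v) = weight k v

  inverseWeight zero    zero    = 1# + ½
  inverseWeight zero    (suc v) = ½
  inverseWeight (suc k) zero    = 1#
  inverseWeight (suc k) (suc v) = inverseWeight k v

  weight-nonneg : ∀ k v → 0# ≤ weight k v
  weight-nonneg zero    zero    = 0≤⅔
  weight-nonneg zero    (suc v) = 0≤2
  weight-nonneg (suc k) zero    = 0≤1
  weight-nonneg (suc k) (suc v) = weight-nonneg k v

  weight-≥1 : ∀ k v → k ≢ v → 1# ≤ weight k v
  weight-≥1 zero    zero    k≢v = contradiction refl k≢v
  weight-≥1 zero    (suc v) k≢v = 1≤2
  weight-≥1 (suc k) zero    k≢v = ≤-refl
  weight-≥1 (suc k) (suc v) k≢v = weight-≥1 k v (k≢v ∘ cong suc)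

  inverseWeight-inverse : ∀ k v → inverseWeight k v * weight k v ≡ 1#
  inverseWeight-inverse zero    zero    = trans (*-comm _ ⅔) ⅔*[1+½]≡1
  inverseWeight-inverse zero    (suc v) = ½*2≡1
  inverseWeight-inverse (suc k) zero    = *-identityʳ 1#
  inverseWeight-inverse (suc k) (suc v) = inverseWeight-inverse k v

  -- Given a draw of at least `k`, the draw equals `k` or exceeds it with probability ½ each, and
  -- the factors 3/2 and ½ average to 1. This requires `k < K`: nothing exceeds the truncation
  -- value.
  𝔼-inverseWeight : ∀ {k K} → k ℕ.< K → 𝔼 (geo K) (inverseWeight k) ≡ 1#
  𝔼-inverseWeight {zero} {suc K} (s≤s _) = begin-equality
    𝔼 (geo (suc K)) (inverseWeight 0)              ≡⟨ 𝔼-geo-suc K (inverseWeight 0) ⟩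
    ½ * (1# + ½ + 𝔼 (geo K) (const ½))             ≡⟨ cong (λ e → ½ * (1# + ½ + e)) (𝔼-const ½ (geo K)) ⟩
    ½ * (1# + ½ + ½)                               ≡⟨ cong (½ *_) (trans (+-assoc 1# ½ ½) (cong (1# +_) ½+½≡1)) ⟩
    ½ * (1# + 1#)                                  ≡⟨ ½*[x+x]≡x 1# ⟩
    1#                                             ∎
  𝔼-inverseWeight {suc k} {suc K} (s≤s k<K) = begin-equality
    𝔼 (geo (suc K)) (inverseWeight (suc k))        ≡⟨ 𝔼-geo-suc K (inverseWeight (suc k)) ⟩
    ½ * (1# + 𝔼 (geo K) (inverseWeight k))         ≡⟨ cong (λ e → ½ * (1# + e)) (𝔼-inverseWeight k<K) ⟩
    ½ * (1# + 1#)                                  ≡⟨ ½*[x+x]≡x 1# ⟩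
    1#                                             ∎

  -- With z copies of k and t larger values left, the potential (2/3)ᶻ 2ᵗ is a
  -- martingale since a draw from geo hits k and the values above k equally
  -- often, and it is at least 1 once the copies of k have run out.
  potential : ∀ {n} → ℕ → Vec ℕ n → ℝ
  potential k []      = 1#
  potential k (v ∷ a) = weight k v * potential k a

  potential-nonneg : ∀ {n} k (a : Vec ℕ n) → 0# ≤ potential k a
  potential-nonneg k []      = 0≤1
  potential-nonneg k (v ∷ a) = *-nonneg (weight-nonneg k v) (potential-nonneg k a)

  potential-≥1 : ∀ {n} k (a : Vec ℕ n) → ¬ k ∈ a → 1# ≤ potential k a
  potential-≥1 k []      k∉a = ≤-refl
  potential-≥1 k (v ∷ a) k∉a = subst (_≤ weight k v * potential k a) (*-identityʳ 1#)
    (*-mono-≤ 0≤1 (potential-nonneg k a) (weight-≥1 k v (k∉a ∘ here)) (potential-≥1 k a (k∉a ∘ there)))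

  potential-removeAt : ∀ {n} k (a : Vec ℕ (suc n)) j →
                       potential k (removeAt a j) ≡ potential k a * inverseWeight k (lookup a j)
  potential-removeAt k (v ∷ a) zero = begin-equality
    potential k a                                       ≡⟨ *-identityˡ _ ⟨
    1# * potential k a                                  ≡⟨ cong (_* potential k a) (inverseWeight-inverse k v) ⟨
    inverseWeight k v * weight k v * potential k a
      ≡⟨ solve 3 (λ i w p → i :* w :* p := w :* p :* i) refl (inverseWeight k v) (weight k v) (potential k a) ⟩
    weight k v * potential k a * inverseWeight k v      ∎
  potential-removeAt k (v ∷ a@(_ ∷ _)) (suc j) =
    trans (cong (weight k v *_) (potential-removeAt k a j)) (sym (*-assoc (weight k v) _ _))

  -- Only levels below `K` are summed, because running out of the top value is not a failure. The
  -- sum serves as a union bound over the levels that may fail.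
  totalPotential : ∀ {n} → ℕ → Vec ℕ n → ℝ
  totalPotential zero    a = 0#
  totalPotential (suc K) a = potential K a + totalPotential K a

  totalPotential-nonneg : ∀ {n} K (a : Vec ℕ n) → 0# ≤ totalPotential K a
  totalPotential-nonneg zero    a = ≤-refl
  totalPotential-nonneg (suc K) a = +-nonneg (potential-nonneg K a) (totalPotential-nonneg K a)

  totalPotential-≥1 : ∀ {n k K} (a : Vec ℕ n) → k ℕ.< K → ¬ k ∈ a → 1# ≤ totalPotential K a
  totalPotential-≥1 {k = k} {suc K} a (s≤s k≤K) k∉a with ℕ.m≤n⇒m<n∨m≡n k≤K
  ... | inj₂ refl = ≤-trans (potential-≥1 k a k∉a) (x≤x+y _ (totalPotential-nonneg k a))
  ... | inj₁ k<K  = ≤-trans (totalPotential-≥1 a k<K k∉a) (x≤y+x (potential-nonneg K a))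

  module _ {n K} (a : Vec ℕ (suc n)) (all∈a : ∀ v → v ℕ.≤ K → v ∈ a) where

    𝔼-potential : ∀ {k} → k ℕ.< K → 𝔼 (geo K) (λ v → potential k (removeAt a (find a v))) ≡ potential k a
    𝔼-potential {k} k<K = begin-equality
      𝔼 (geo K) (λ v → potential k (removeAt a (find a v)))
        ≡⟨ 𝔼-cong (geo K) (geo-≤ K) (λ v v≤K → trans (potential-removeAt k a (find a v))
             (cong (λ w → potential k a * inverseWeight k w) (lookup-find a (all∈a v v≤K)))) ⟩
      𝔼 (geo K) (λ v → potential k a * inverseWeight k v)     ≡⟨ 𝔼-* (geo K) _ _ ⟩
      potential k a * 𝔼 (geo K) (inverseWeight k)             ≡⟨ cong (potential k a *_) (𝔼-inverseWeight k<K) ⟩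
      potential k a * 1#                                      ≡⟨ *-identityʳ _ ⟩
      potential k a                                           ∎

    𝔼-totalPotential : ∀ J → J ℕ.≤ K →
      𝔼 (geo K) (λ v → totalPotential J (removeAt a (find a v))) ≡ totalPotential J a
    𝔼-totalPotential zero    J≤K = 𝔼-const 0# (geo K)
    𝔼-totalPotential (suc J) J<K = trans (𝔼-+ (geo K) _ _)
      (cong₂ _+_ (𝔼-potential J<K) (𝔼-totalPotential J (ℕ.<⇒≤ J<K)))

-- The score against the adversary's order.

module Adversary (𝓡 : RealNumbers) where
  open RealNumbers 𝓡
  open RealProperties 𝓡
  open CoinExpectation 𝓡
  open Geometric 𝓡
  open Game 𝓡
  open Potential 𝓡
  open Strategy
  open ≤-Reasoning

  remainingUtility-≤ : ∀ t {x} → 0# ≤ x → remainingUtility 𝓡 t x ≤ x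
  remainingUtility-≤ ∞              0≤x = 0≤x
  remainingUtility-≤ (finite θ 0≤θ) 0≤x = ⊔-lub (a≤b+c⇒a-c≤b (x≤x+y _ 0≤θ)) 0≤x

  play-≤ : ∀ s h {n} {xs : Vec ℝ n} {u} → 0# ≤ u → All (λ x → 0# ≤ x × x ≤ u) xs → play 𝓡 s h xs ≤ u
  play-≤ s h 0≤u []                          = 0≤u
  play-≤ s h 0≤u (_∷_ {x = x} (0≤x , x≤u) xs≤u) = if-≤ (accept s h (test 𝓡 (threshold s h) x))
    (≤-trans (remainingUtility-≤ (threshold s h) 0≤x) x≤u) (play-≤ s _ 0≤u xs≤u)

  play-permute-≤ : ∀ s h {n} {a : Vec ℕ n} {B} → All (ℕ._≤ B) a → ∀ σ →
                   play 𝓡 s h (permute 𝓡 σ (values a)) ≤ fromℕ B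
  play-permute-≤ s h {a = a} {B} a≤B σ = play-≤ s h (0≤fromℕ B) (All.tabulate⁺ λ i →
    subst (λ x → 0# ≤ x × x ≤ fromℕ B) (sym (Vec.lookup-map (σ ⟨$⟩ʳ i) fromℕ a))
      (0≤fromℕ (lookup a (σ ⟨$⟩ʳ i)) , fromℕ-mono-≤ (All.lookup⁺ a≤B (σ ⟨$⟩ʳ i))))

  All-≤-pred : ∀ {K n} {a : Vec ℕ n} → All (ℕ._≤ suc K) a → ¬ suc K ∈ a → All (ℕ._≤ K) a
  All-≤-pred []         K∉a = []
  All-≤-pred (v≤ ∷ a≤)  K∉a = ℕ.≤-pred (ℕ.≤∧≢⇒< v≤ λ v≡ → K∉a (here (sym v≡))) ∷ All-≤-pred a≤ (K∉a ∘ there)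

  -- The potential term pays for giving up: at a gap it is at least `M`, which bounds any score.
  -- While all levels are in stock, `stop-excess` gives the 2 and the martingale property preserves
  -- the potential; when the top value runs out, the potential loses a nonnegative summand. `M`
  -- stays fixed while the range `K` shrinks.
  order-score-≤ : ∀ (s : Strategy 𝓡) M K {n} (a : Vec ℕ n) h → All (ℕ._≤ M) a → All (ℕ._≤ K) a →
    𝔼 (order K a) (λ σ → play 𝓡 s h (permute 𝓡 σ (values a))) ≤ 2# + fromℕ M * totalPotential K a
  order-score-≤ s M zero a h a≤M a≤K = ≤-trans (play-permute-≤ s h a≤K Perm.id)
    (+-nonneg 0≤2 (*-nonneg (0≤fromℕ M) ≤-refl))
  order-score-≤ s M (suc K) {zero} a h a≤M a≤K =
    +-nonneg 0≤2 (*-nonneg (0≤fromℕ M) (totalPotential-nonneg (suc K) a))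
  order-score-≤ s M (suc K) {suc n} a h a≤M a≤K with supply K a
  ... | exhausted K∉a = ≤-trans (order-score-≤ s M K a h a≤M (All-≤-pred a≤K K∉a))
    (+-monoʳ-≤ 2# (*-monoʳ-≤ (0≤fromℕ M) (x≤y+x (potential-nonneg K a))))
  ... | gap k k<1+K k∉a = begin
    play 𝓡 s h (permute 𝓡 Perm.id (values a))  ≤⟨ play-permute-≤ s h a≤M Perm.id ⟩
    fromℕ M                                    ≡⟨ *-identityʳ (fromℕ M) ⟨
    fromℕ M * 1#                               ≤⟨ *-monoʳ-≤ (0≤fromℕ M) (totalPotential-≥1 a k<1+K k∉a) ⟩
    fromℕ M * totalPotential (suc K) a         ≤⟨ x≤y+x 0≤2 ⟩
    2# + fromℕ M * totalPotential (suc K) a    ∎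
  ... | stocked all∈a = begin
    𝔼 (geo (suc K) >>= λ v → map (Perm.insert zero (find a v)) (rest v)) F
      ≡⟨ 𝔼-bind (geo (suc K)) _ F ⟩
    𝔼 (geo (suc K)) (λ v → 𝔼 (map (Perm.insert zero (find a v)) (rest v)) F)
      ≤⟨ 𝔼-mono (geo (suc K)) (geo-≤ (suc K)) draw ⟩
    𝔼 (geo (suc K)) (λ v → (if stops s h v then gains s h v else 2#) + fromℕ M * Φ v)
      ≡⟨ 𝔼-+ (geo (suc K)) _ _ ⟩
    𝔼 (geo (suc K)) (λ v → if stops s h v then gains s h v else 2#) + 𝔼 (geo (suc K)) (λ v → fromℕ M * Φ v)
      ≤⟨ +-mono-≤ (stop-excess (suc K) (threshold s h) (accept s h))
           (≤-reflexive (trans (𝔼-* (geo (suc K)) _ _)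
             (cong (fromℕ M *_) (𝔼-totalPotential a all∈a (suc K) ℕ.≤-refl)))) ⟩
    2# + fromℕ M * totalPotential (suc K) a    ∎
    where
    F : Permutation′ (suc n) → ℝ
    F σ = play 𝓡 s h (permute 𝓡 σ (values a))

    rest : ℕ → Coins (Permutation′ n)
    rest v = order (suc K) (removeAt a (find a v))

    Φ : ℕ → ℝ
    Φ v = totalPotential (suc K) (removeAt a (find a v))

    0≤MΦ : ∀ v → 0# ≤ fromℕ M * Φ v
    0≤MΦ v = *-nonneg (0≤fromℕ M) (totalPotential-nonneg (suc K) (removeAt a (find a v)))

    first : ∀ v → 𝔼 (rest v) (λ ρ → play 𝓡 s h (fromℕ v ∷ permute 𝓡 ρ (values (removeAt a (find a v))))) ≤
                  (if stops s h v then gains s h v else 2#) + fromℕ M * Φ v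
    first v with stops s h v
    ... | true  = ≤-trans (≤-reflexive (𝔼-const (gains s h v) (rest v))) (x≤x+y _ (0≤MΦ v))
    ... | false = order-score-≤ s M (suc K) (removeAt a (find a v)) (next s h v)
                    (All-removeAt a≤M (find a v)) (All-removeAt a≤K (find a v))

    draw : ∀ v → v ℕ.≤ suc K → 𝔼 (map (Perm.insert zero (find a v)) (rest v)) F ≤
                 (if stops s h v then gains s h v else 2#) + fromℕ M * Φ v
    draw v v≤1+K = begin
      𝔼 (map (Perm.insert zero (find a v)) (rest v)) F
        ≡⟨ 𝔼-map (rest v) (Perm.insert zero (find a v)) F ⟩
      𝔼 (rest v) (λ ρ → play 𝓡 s h (permute 𝓡 (Perm.insert zero (find a v) ρ) (values a)))
        ≡⟨ 𝔼-ext (rest v) (λ ρ → cong (play 𝓡 s h) (trans (permute-insert a (find a v) ρ)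
             (cong (λ w → fromℕ w ∷ permute 𝓡 ρ (values (removeAt a (find a v)))) (lookup-find a (all∈a v v≤1+K))))) ⟩
      𝔼 (rest v) (λ ρ → play 𝓡 s h (fromℕ v ∷ permute 𝓡 ρ (values (removeAt a (find a v)))))
        ≤⟨ first v ⟩
      (if stops s h v then gains s h v else 2#) + fromℕ M * Φ v ∎

  -- Construction of the hard multiset.

  potential-replicate : ∀ z {m} (b : Vec ℕ m) →
    potential 0 (Vec.replicate z 0 Vec.++ Vec.map suc b) ≡ ⅔ ^ z * 2# ^ m
  potential-replicate (suc z) b       = trans (cong (⅔ *_) (potential-replicate z b)) (sym (*-assoc ⅔ _ _))
  potential-replicate zero    []      = sym (*-identityʳ 1#)
  potential-replicate zero    {suc m} (v ∷ b) = trans (cong (2# *_) (potential-replicate zero b))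
    (solve 2 (λ x y → x :* (con 1 :* y) := con 1 :* (x :* y)) refl 2# (2# ^ m))

  -- Each factor 2 is charged to four factors ⅔, and squaring ⅔² · 2 ≤ 1 gives ⅔⁴ · 2 ≤ ½; surplus
  -- factors ⅔ only help.
  ⅔^z*2^m≤½^m : ∀ m z → m ℕ.* 4 ℕ.≤ z → ⅔ ^ z * 2# ^ m ≤ ½ ^ m
  ⅔^z*2^m≤½^m zero    z       _ = subst (_≤ 1#) (sym (*-identityʳ (⅔ ^ z))) (^-≤1 0≤⅔ ⅔≤1 z)
  ⅔^z*2^m≤½^m (suc m) (suc (suc (suc (suc z)))) (s≤s (s≤s (s≤s (s≤s 4m≤z)))) = begin
    ⅔ * (⅔ * (⅔ * (⅔ * ⅔ ^ z))) * (2# * 2# ^ m)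
      ≡⟨ solve 4 (λ x t a b → x :* (x :* (x :* (x :* a))) :* (t :* b) := (x :* x) :* ((x :* x) :* t) :* (a :* b)) refl
           ⅔ 2# (⅔ ^ z) (2# ^ m) ⟩
    (⅔ * ⅔) * ((⅔ * ⅔) * 2#) * (⅔ ^ z * 2# ^ m)
      ≤⟨ *-mono-≤ (*-nonneg 0≤⅔² (*-nonneg 0≤⅔² 0≤2)) (^-nonneg 0≤½ m) ⅔⁴*2≤½ (⅔^z*2^m≤½^m m z 4m≤z) ⟩
    ½ * ½ ^ m ∎
    where
    0≤⅔² : 0# ≤ ⅔ * ⅔
    0≤⅔² = *-nonneg 0≤⅔ 0≤⅔

    ⅔⁴*2≤½ : (⅔ * ⅔) * ((⅔ * ⅔) * 2#) ≤ ½
    ⅔⁴*2≤½ = begin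
      (⅔ * ⅔) * ((⅔ * ⅔) * 2#)                 ≡⟨ ½*2x≡x _ ⟨
      ½ * (2# * ((⅔ * ⅔) * ((⅔ * ⅔) * 2#)))    ≡⟨ solve 3 (λ h t y → h :* (t :* (y :* (y :* t))) := h :* ((y :* t) :* (y :* t))) refl ½ 2# (⅔ * ⅔) ⟩
      ½ * ((⅔ * ⅔ * 2#) * (⅔ * ⅔ * 2#))        ≤⟨ *-monoʳ-≤ 0≤½ (*-mono-≤ (*-nonneg 0≤⅔² 0≤2) 0≤1 ⅔²*2≤1 ⅔²*2≤1) ⟩
      ½ * (1# * 1#)                            ≡⟨ trans (cong (½ *_) (*-identityʳ 1#)) (*-identityʳ ½) ⟩
      ½                                        ∎

  potential-shift : ∀ z {m} k (b : Vec ℕ m) →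
    potential (suc k) (Vec.replicate z 0 Vec.++ Vec.map suc b) ≡ potential k b
  potential-shift (suc z) k b       = trans (*-identityˡ _) (potential-shift z k b)
  potential-shift zero    k []      = refl
  potential-shift zero    k (v ∷ b) = cong (weight k v *_) (potential-shift zero k b)

  totalPotential-shift : ∀ z {m} K (b : Vec ℕ m) → let a = Vec.replicate z 0 Vec.++ Vec.map suc b in
    totalPotential (suc K) a ≡ potential 0 a + totalPotential K b
  totalPotential-shift z zero    b = refl
  totalPotential-shift z (suc K) b = trans
    (cong₂ _+_ (potential-shift z K b) (totalPotential-shift z K b))
    (solve 3 (λ x y z → x :+ (y :+ z) := y :+ (x :+ z)) refl (potential K b) _ (totalPotential K b))

  -- Each level holds at least four times as many copies as all higher levels
  -- together, since (2/3)⁴ 2 ≤ ½; the top level holds s copies.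
  record HardMultiset (M n s : ℕ) : Set where
    field
      multiset : Vec ℕ n
      bounded  : All (ℕ._≤ M) multiset
      top      : M ∈ multiset
      lowPotential : totalPotential M multiset ≤ fromℕ M * ½ ^ s

  -- The multiset for `M` on exactly `m` = 5ᴹ s options is raised by one, and the remaining
  -- `n - m ≥ 4m` options become zeros. Raising leaves the old potentials unchanged, and the new
  -- level adds at most ½ᵐ ≤ ½ˢ.
  hardMultiset : ∀ M n s → 1 ℕ.≤ s → 5 ℕ.^ M ℕ.* s ℕ.≤ n → HardMultiset M n s
  hardMultiset zero    n s 1≤s s≤n with ℕ.≤-trans 1≤s (ℕ.≤-trans (ℕ.m≤m+n s 0) s≤n)
  ... | s≤s _ = record
    { multiset = Vec.replicate n 0
    ; bounded  = All-replicate z≤n n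
    ; top      = here refl
    ; lowPotential = *-nonneg ≤-refl (^-nonneg 0≤½ s)
    }
  hardMultiset (suc M) n s 1≤s 5^M*s≤n = subst (λ n → HardMultiset (suc M) n s) (ℕ.m∸n+n≡m m≤n) (record
    { multiset = zeros Vec.++ Vec.map suc b
    ; bounded  = All.++⁺ (All-replicate z≤n z) (All.map⁺ (All.map s≤s bounded))
    ; top      = ∈-++⁺ʳ zeros (∈-map⁺ suc top)
    ; lowPotential = begin
        totalPotential (suc M) (zeros Vec.++ Vec.map suc b)          ≡⟨ totalPotential-shift z M b ⟩
        potential 0 (zeros Vec.++ Vec.map suc b) + totalPotential M b
          ≤⟨ +-mono-≤ (≤-reflexive (potential-replicate z b)) lowPotential ⟩
        ⅔ ^ z * 2# ^ m + fromℕ M * ½ ^ s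
          ≤⟨ +-monoˡ-≤ _ (≤-trans (⅔^z*2^m≤½^m m z 4m≤z) (^-antimono-≤ 0≤½ ½≤1 s≤m)) ⟩
        ½ ^ s + fromℕ M * ½ ^ s
          ≡⟨ solve 2 (λ x y → x :+ y :* x := (con 1 :+ y) :* x) refl (½ ^ s) (fromℕ M) ⟩
        fromℕ (suc M) * ½ ^ s                                        ∎
    })
    where
    m = 5 ℕ.^ M ℕ.* s
    z = n ℕ.∸ m
    zeros = Vec.replicate z 0
    open HardMultiset (hardMultiset M m s 1≤s ℕ.≤-refl) renaming (multiset to b)

    s≤m : s ℕ.≤ m
    s≤m = ℕ.≤-trans (ℕ.≤-reflexive (sym (ℕ.+-identityʳ s))) (ℕ.*-monoˡ-≤ s (ℕ.m^n>0 5 M))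

    5m≤n : m ℕ.+ m ℕ.* 4 ℕ.≤ n
    5m≤n = ℕ.≤-trans (ℕ.≤-reflexive (trans (cong (m ℕ.+_) (ℕ.*-comm m 4)) (sym (ℕ.*-assoc 5 (5 ℕ.^ M) s)))) 5^M*s≤n

    m≤n : m ℕ.≤ n
    m≤n = ℕ.≤-trans (ℕ.m≤m+n m _) 5m≤n

    4m≤z : m ℕ.* 4 ℕ.≤ z
    4m≤z = ℕ.m+n≤o⇒m≤o∸n (m ℕ.* 4) (subst (ℕ._≤ n) (ℕ.+-comm m _) 5m≤n)

  M*½^M≤1 : ∀ M → fromℕ M * ½ ^ M ≤ 1#
  M*½^M≤1 zero    = subst (_≤ 1#) (sym (zeroˡ 1#)) 0≤1
  M*½^M≤1 (suc M) = begin
    (1# + fromℕ M) * (½ * ½ ^ M)          ≡⟨ solve 3 (λ m h p → (con 1 :+ m) :* (h :* p) := h :* (p :+ m :* p)) refl (fromℕ M) ½ (½ ^ M) ⟩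
    ½ * (½ ^ M + fromℕ M * ½ ^ M)         ≤⟨ *-monoʳ-≤ 0≤½ (+-mono-≤ (^-≤1 0≤½ ½≤1 M) (M*½^M≤1 M)) ⟩
    ½ * (1# + 1#)                         ≡⟨ ½*[x+x]≡x 1# ⟩
    1#                                    ∎

  M*[M*½^2M]≤1 : ∀ M → fromℕ M * (fromℕ M * ½ ^ (M ℕ.+ M)) ≤ 1#
  M*[M*½^2M]≤1 M = begin
    fromℕ M * (fromℕ M * ½ ^ (M ℕ.+ M))        ≡⟨ cong (λ p → fromℕ M * (fromℕ M * p)) (^-homo-* ½ M M) ⟩
    fromℕ M * (fromℕ M * (½ ^ M * ½ ^ M))      ≡⟨ solve 2 (λ m p → m :* (m :* (p :* p)) := (m :* p) :* (m :* p)) refl (fromℕ M) (½ ^ M) ⟩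
    (fromℕ M * ½ ^ M) * (fromℕ M * ½ ^ M)      ≤⟨ *-mono-≤ (*-nonneg (0≤fromℕ M) (^-nonneg 0≤½ M)) 0≤1 (M*½^M≤1 M) (M*½^M≤1 M) ⟩
    1# * 1#                                    ≡⟨ *-identityʳ 1# ⟩
    1#                                         ∎

  2M≤3^M : ∀ M → M ℕ.+ M ℕ.≤ 3 ℕ.^ M
  2M≤3^M zero    = z≤n
  2M≤3^M (suc M) = ℕ.≤-trans (ℕ.≤-reflexive (trans (cong suc (ℕ.+-suc M M)) (ℕ.+-comm 2 (M ℕ.+ M))))
    (ℕ.+-mono-≤ (2M≤3^M M) (ℕ.+-mono-≤ (ℕ.m^n>0 3 M) (ℕ.≤-trans (ℕ.m^n>0 3 M) (ℕ.m≤m+n _ 0))))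

  5^M*3^M≤16^M : ∀ M → 5 ℕ.^ M ℕ.* 3 ℕ.^ M ℕ.≤ 16 ℕ.^ M
  5^M*3^M≤16^M zero    = ℕ.≤-refl
  5^M*3^M≤16^M (suc M) = ℕ.≤-trans
    (ℕ.≤-reflexive (ℕ.[m*n]*[o*p]≡[m*o]*[n*p] 5 (5 ℕ.^ M) 3 (3 ℕ.^ M)))
    (ℕ.*-mono-≤ (ℕ.n≤1+n 15) (5^M*3^M≤16^M M))

  -- Base 16 accommodates both the growth by 5 per level and the `M + M` top copies, as 2M ≤ 3ᴹ and
  -- 5 · 3 ≤ 16; being a power of 2, it also converts easily to `log₂`.
  5^M*2M≤16^M : ∀ M → 5 ℕ.^ M ℕ.* (M ℕ.+ M) ℕ.≤ 16 ℕ.^ M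
  5^M*2M≤16^M M = ℕ.≤-trans (ℕ.*-monoʳ-≤ (5 ℕ.^ M) (2M≤3^M M)) (5^M*3^M≤16^M M)

  -- With `M + M` copies of the top value the initial potential is at most M · 4⁻ᴹ, so the cost of
  -- giving up, M² · 4⁻ᴹ, is at most 1.
  hard-order-≤3 : ∀ (s : Strategy 𝓡) {M n} (hard : HardMultiset M n (M ℕ.+ M)) →
    let open HardMultiset hard in
    𝔼 (order M multiset) (λ σ → score 𝓡 s (permute 𝓡 σ (values multiset))) ≤ 3#
  hard-order-≤3 s {M} hard = begin
    𝔼 (order M multiset) (λ σ → score 𝓡 s (permute 𝓡 σ (values multiset)))
      ≤⟨ order-score-≤ s M M multiset [] bounded bounded ⟩
    2# + fromℕ M * totalPotential M multiset
      ≤⟨ +-monoʳ-≤ 2# (≤-trans (*-monoʳ-≤ (0≤fromℕ M) lowPotential) (M*[M*½^2M]≤1 M)) ⟩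
    2# + 1#
      ≡⟨ solve 0 (nat 2 :+ con 1 := nat 3) refl ⟩
    3# ∎
    where open HardMultiset hard

-- From bounded scores to the logarithmic lower bound on the ratio.

module LowerBound (𝓡 : RealNumbers) where
  open RealNumbers 𝓡
  open RealProperties 𝓡
  open CoinExpectation 𝓡
  open Geometric 𝓡
  open Game 𝓡
  open Adversary 𝓡
  open ≤-Reasoning

  *-cancelʳ-≤ : ∀ {x y d} → 0# ≤ d → d ≢ 0# → x * d ≤ y * d → x ≤ y
  *-cancelʳ-≤ {x} {y} {d} 0≤d d≢0 xd≤yd = subst₂ _≤_ (cancel x) (cancel y) (*-monoˡ-≤ (⁻¹-nonneg 0≤d d≢0) xd≤yd)
    where
    cancel : ∀ z → z * d * d ⁻¹ ≡ z
    cancel z = trans (*-assoc z d (d ⁻¹)) (trans (cong (z *_) (*-inverseʳ d≢0)) (*-identityʳ z))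

  fromℕ≢0 : ∀ {n} → 1 ℕ.≤ n → fromℕ n ≢ 0#
  fromℕ≢0 {suc n} _ = fromℕ-suc≢0 n

  /-*-cancel : ∀ x {d} → d ≢ 0# → x / d * d ≡ x
  /-*-cancel x {d} d≢0 = trans (*-assoc x (d ⁻¹) d)
    (trans (cong (x *_) (trans (*-comm (d ⁻¹) d) (*-inverseʳ d≢0))) (*-identityʳ x))

  -- If `p / suc q` lies below the logarithm, then 2ᵖ is at most 2 to the power `L * suc q`, and
  -- comparing exponents makes `L` an upper bound of the set.
  log₂-≤ : ∀ n .{{_ : NonZero n}} L → n ℕ.≤ 2 ℕ.^ L → log₂ n ≤ fromℕ L
  log₂-≤ n L n≤2^L = proj₂ (proj₂ (log₂-supremum n)) bound
    where
    bound : IsUpperBound (RationalBelowLog₂ n) (fromℕ L)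
    bound (p , q , 2^p≤n^q , refl) = *-cancelʳ-≤ (0≤fromℕ (suc q)) (fromℕ-suc≢0 q)
      (subst₂ _≤_ (sym (/-*-cancel (fromℕ p) (fromℕ-suc≢0 q))) (fromℕ-homo-* L (suc q)) (fromℕ-mono-≤ p≤Lq))
      where
      p≤Lq : p ℕ.≤ L ℕ.* suc q
      p≤Lq = ℕ.≮⇒≥ λ Lq<p → ℕ.<-irrefl refl
        (ℕ.<-≤-trans (ℕ.^-monoʳ-< 2 (s≤s (s≤s z≤n)) Lq<p)
          (ℕ.≤-trans 2^p≤n^q (ℕ.≤-trans (ℕ.^-monoˡ-≤ (suc q) n≤2^L)
            (ℕ.≤-reflexive (ℕ.^-*-assoc 2 L (suc q))))))

  log₁₆ : ∀ n → 1 ℕ.≤ n → ∃ λ M → 16 ℕ.^ M ℕ.≤ n × n ℕ.< 16 ℕ.^ suc M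
  log₁₆ (suc zero)      _ = 0 , s≤s z≤n , s≤s (s≤s z≤n)
  log₁₆ (suc n@(suc _)) _ with log₁₆ n (s≤s z≤n)
  ... | M , 16^M≤n , n<16^[1+M] with suc n ℕ.<? 16 ℕ.^ suc M
  ...   | yes 1+n< = M , ℕ.m≤n⇒m≤1+n 16^M≤n , 1+n<
  ...   | no  1+n≮ = suc M , ℕ.≮⇒≥ 1+n≮ ,
    ℕ.≤-<-trans n<16^[1+M] (ℕ.^-monoʳ-< 16 (s≤s (s≤s z≤n)) (ℕ.n<1+n (suc M)))

  maximum-≤ : ∀ {n} {a : Vec ℕ n} {B} → All (ℕ._≤ B) a → maximum 𝓡 (values a) ≤ fromℕ B
  maximum-≤ {B = B} [] = 0≤fromℕ B
  maximum-≤ (v≤B ∷ a≤B) = ⊔-lub (fromℕ-mono-≤ v≤B) (maximum-≤ a≤B)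

  ∈⇒≤maximum : ∀ {n} {a : Vec ℕ n} {v} → v ∈ a → fromℕ v ≤ maximum 𝓡 (values a)
  ∈⇒≤maximum {a = w ∷ a} (here refl) = x≤x⊔y (fromℕ w) (maximum 𝓡 (values a))
  ∈⇒≤maximum {a = w ∷ a} (there v∈a) = ≤-trans (∈⇒≤maximum v∈a) (x≤y⊔x (fromℕ w) (maximum 𝓡 (values a)))

  values-instance : ∀ {n} (a : Vec ℕ n) → IsInstance 𝓡 (values a)
  values-instance []      = []
  values-instance (v ∷ a) = 0≤fromℕ v ∷ values-instance a

  iid-≤ : ∀ K n → Support (All (ℕ._≤ K)) (iid K n)
  iid-≤ K zero    = []
  iid-≤ K (suc n) = support-bind (geo K) (geo-≤ K) λ v v≤K →
    support-bind (iid K n) (iid-≤ K n) λ b b≤K → v≤K ∷ b≤K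

  module _ {α : ℝ} (0<α : 0# < α) where

    0≤α⁻¹ : 0# ≤ α ⁻¹
    0≤α⁻¹ = ⁻¹-nonneg (proj₁ 0<α) (≢-sym (proj₂ 0<α))

    -- The guarantee holds for every instance `M ∷ b`, hence on average over iid `b`, where
    -- `hidden-total-≤3` caps the score of each strategy.
    random-order-bound : ∀ {n} M → 2 ℕ.^ M ℕ.≤ suc n → (p : Player 𝓡 optimumInformation (suc n)) →
                         CompetitiveInRandomOrder 𝓡 α p → α ⁻¹ * fromℕ M ≤ 3#
    random-order-bound {n} M 2^M≤1+n p competitive = *-cancelʳ-≤ (0≤fromℕ (suc n !)) n!≢0 (begin
      α ⁻¹ * fromℕ M * fromℕ (suc n !)       ≤⟨ 𝔼-≥ (iid M n) lower ⟩
      𝔼 (iid M n) (λ b → permutationSum (suc n) (e b))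
        ≤⟨ below-const (below-𝔼 (λ b → below-sum (λ σ → expectation⇒below (expectation b σ)) (permutations (suc n))) (iid M n)) upper ⟩
      fromℕ (suc n !) * 3#                   ≡⟨ *-comm _ 3# ⟩
      3# * fromℕ (suc n !)                   ∎)
      where
      open Player p
      open LowerIntegral 𝓡 randomness

      n!≢0 : fromℕ (suc n !) ≢ 0#
      n!≢0 = fromℕ≢0 (ℕ.1≤n! (suc n))

      a : Vec ℕ n → Vec ℝ (suc n)
      a b = values (M ∷ b)

      competitiveAt = λ b → competitive (a b) (values-instance (M ∷ b))

      e : Vec ℕ n → Permutation′ (suc n) → ℝ
      e b = proj₁ (competitiveAt b)

      expectation : ∀ b σ → IsExpectation (randomScore (a b) σ) (e b σ)
      expectation b = proj₁ (proj₂ (competitiveAt b))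

      lower : ∀ b → α ⁻¹ * fromℕ M * fromℕ (suc n !) ≤ permutationSum (suc n) (e b)
      lower b = begin
        α ⁻¹ * fromℕ M * fromℕ (suc n !)
          ≤⟨ *-monoˡ-≤ (0≤fromℕ (suc n !)) (≤-trans (*-monoʳ-≤ 0≤α⁻¹ (∈⇒≤maximum {a = M ∷ b} (here refl)))
               (proj₂ (proj₂ (competitiveAt b)))) ⟩
        permutationSum (suc n) (e b) / fromℕ (suc n !) * fromℕ (suc n !)  ≡⟨ /-*-cancel _ n!≢0 ⟩
        permutationSum (suc n) (e b)         ∎

      upper : ∀ ω → 𝔼 (iid M n) (λ b → permutationSum (suc n) (λ σ → randomScore (a b) σ ω)) ≤ fromℕ (suc n !) * 3#
      upper ω = ≤-trans
        -- On the support the maximum is always `M`, so the information given says nothing about `b`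
        -- and one strategy, fixed before `b` is drawn, faces the whole average.
        (≤-reflexive (𝔼-cong (iid M n) (iid-≤ M n) λ b b≤M →
          cong (λ m → permutationSum (suc n) λ σ → score 𝓡 (strategy m ω) (permute 𝓡 σ (a b)))
            (antisym (maximum-≤ (ℕ.≤-refl ∷ b≤M)) (∈⇒≤maximum {a = M ∷ b} (here refl)))))
        (hidden-total-≤3 (strategy (fromℕ M) ω) M n [] 2^M≤1+n)

    -- The multiset is fixed and only the permutation is random, so full information fixes the
    -- strategy for each `ω`. The guarantee for every permutation carries over to the average over
    -- the adversary's orders.
    arbitrary-order-bound : ∀ {n} M → 1 ℕ.≤ M → 16 ℕ.^ M ℕ.≤ n → (p : Player 𝓡 fullInformation n) →
                            CompetitiveInArbitraryOrder 𝓡 α p → α ⁻¹ * fromℕ M ≤ 3#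
    arbitrary-order-bound {n} M 1≤M 16^M≤n p competitive = begin
      α ⁻¹ * fromℕ M                ≤⟨ 𝔼-≥ (order M multiset) lower ⟩
      𝔼 (order M multiset) e        ≤⟨ below-const (below-𝔼 (λ σ → expectation⇒below (proj₁ (proj₂ (competitiveAt σ)))) (order M multiset))
                                         (λ ω → hard-order-≤3 (strategy (values multiset) ω) hard) ⟩
      3#                            ∎
      where
      open Player p
      open LowerIntegral 𝓡 randomness

      hard : HardMultiset M n (M ℕ.+ M)
      hard = hardMultiset M n (M ℕ.+ M) (ℕ.≤-trans 1≤M (ℕ.m≤m+n M M)) (ℕ.≤-trans (5^M*2M≤16^M M) 16^M≤n)
      open HardMultiset hard

      competitiveAt = competitive (values multiset) (values-instance multiset)

      e : Permutation′ n → ℝ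
      e σ = proj₁ (competitiveAt σ)

      lower : ∀ σ → α ⁻¹ * fromℕ M ≤ e σ
      lower σ = ≤-trans (*-monoʳ-≤ 0≤α⁻¹ (∈⇒≤maximum top)) (proj₂ (proj₂ (competitiveAt σ)))

    -- Since `M ≤ 3α` and `M ≥ 1`, the bound n < 16ᴹ⁺¹ gives log₂ n ≤ 4(M + 1) ≤ 8M ≤ 24α.
    log-bound : ∀ n .{{_ : NonZero n}} M → 1 ℕ.≤ M → n ℕ.< 16 ℕ.^ suc M → α ⁻¹ * fromℕ M ≤ 3# →
                fromℕ 24 ⁻¹ * log₂ n ≤ α
    log-bound n M 1≤M n<16^[1+M] M≤3α = begin
      fromℕ 24 ⁻¹ * log₂ n                  ≤⟨ *-monoʳ-≤ 0≤1/24 (log₂-≤ n (4 ℕ.* suc M) n≤2^4[1+M]) ⟩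
      fromℕ 24 ⁻¹ * fromℕ (4 ℕ.* suc M)     ≤⟨ *-monoʳ-≤ 0≤1/24 (fromℕ-mono-≤ 4[1+M]≤8M) ⟩
      fromℕ 24 ⁻¹ * fromℕ (8 ℕ.* M)         ≡⟨ cong (fromℕ 24 ⁻¹ *_) (fromℕ-homo-* 8 M) ⟩
      fromℕ 24 ⁻¹ * (fromℕ 8 * fromℕ M)     ≡⟨ cong (λ m → fromℕ 24 ⁻¹ * (fromℕ 8 * m)) M≡ ⟩
      fromℕ 24 ⁻¹ * (fromℕ 8 * (α ⁻¹ * fromℕ M * α))
        ≤⟨ *-monoʳ-≤ 0≤1/24 (*-monoʳ-≤ (0≤fromℕ 8) (*-monoˡ-≤ (proj₁ 0<α) M≤3α)) ⟩
      fromℕ 24 ⁻¹ * (fromℕ 8 * (3# * α))    ≡⟨ cong (fromℕ 24 ⁻¹ *_) (sym (*-assoc (fromℕ 8) 3# α)) ⟩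
      fromℕ 24 ⁻¹ * (fromℕ 8 * 3# * α)      ≡⟨ cong (λ c → fromℕ 24 ⁻¹ * (c * α)) (fromℕ-homo-* 8 3) ⟨
      fromℕ 24 ⁻¹ * (fromℕ 24 * α)          ≡⟨ *-assoc _ _ α ⟨
      fromℕ 24 ⁻¹ * fromℕ 24 * α            ≡⟨ cong (_* α) (trans (*-comm _ (fromℕ 24)) (*-inverseʳ (fromℕ-suc≢0 23))) ⟩
      1# * α                                ≡⟨ *-identityˡ α ⟩
      α                                     ∎
      where
      0≤1/24 : 0# ≤ fromℕ 24 ⁻¹
      0≤1/24 = ⁻¹-nonneg (0≤fromℕ 24) (fromℕ-suc≢0 23)

      n≤2^4[1+M] : n ℕ.≤ 2 ℕ.^ (4 ℕ.* suc M)
      n≤2^4[1+M] = ℕ.≤-trans (ℕ.<⇒≤ n<16^[1+M]) (ℕ.≤-reflexive (ℕ.^-*-assoc 2 4 (suc M)))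

      4[1+M]≤8M : 4 ℕ.* suc M ℕ.≤ 8 ℕ.* M
      4[1+M]≤8M = ℕ.≤-trans (ℕ.*-monoʳ-≤ 4 (ℕ.+-mono-≤ 1≤M (ℕ.≤-reflexive (sym (ℕ.+-identityʳ M)))))
        (ℕ.≤-reflexive (sym (ℕ.*-assoc 4 2 M)))

      M≡ : fromℕ M ≡ α ⁻¹ * fromℕ M * α
      M≡ = sym (trans (cong (_* α) (*-comm (α ⁻¹) (fromℕ M))) (/-*-cancel (fromℕ M) (≢-sym (proj₂ 0<α))))

  0<1/24 : 0# < fromℕ 24 ⁻¹
  0<1/24 = ⁻¹-nonneg (0≤fromℕ 24) (fromℕ-suc≢0 23) , λ 0≡1/24 → 0≢1 (begin-equality
    0#                        ≡⟨ zeroʳ (fromℕ 24) ⟨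
    fromℕ 24 * 0#             ≡⟨ cong (fromℕ 24 *_) 0≡1/24 ⟩
    fromℕ 24 * fromℕ 24 ⁻¹    ≡⟨ *-inverseʳ (fromℕ-suc≢0 23) ⟩
    1#                        ∎)

  1≤log₁₆ : ∀ {n} M → 16 ℕ.≤ n → n ℕ.< 16 ℕ.^ suc M → 1 ℕ.≤ M
  1≤log₁₆ zero    16≤n n<16 = contradiction (ℕ.<-≤-trans n<16 16≤n) (ℕ.<-irrefl refl)
  1≤log₁₆ (suc M) _    _    = s≤s z≤n

theorem4 : (𝓡 : RealNumbers) → let open RealNumbers 𝓡 in
    ∃ λ (c : ℝ) → 0# < c × ∃ λ (N : ℕ) → (n : ℕ) .{{_ : NonZero n}} → N ℕ.≤ n →
    ((α : ℝ) → 0# < α →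
    (∃ λ (p : Player 𝓡 optimumInformation n) → CompetitiveInRandomOrder 𝓡 α p) →
    c * log₂ n ≤ α)
    ×
    ((α : ℝ) → 0# < α →
    (∃ λ (p : Player 𝓡 fullInformation n) → CompetitiveInArbitraryOrder 𝓡 α p) →
    c * log₂ n ≤ α)
-- The constant comes from `log-bound`, whose hypothesis `1 ≤ M` on the integer part `M` of log₁₆ n
-- holds from n = 16 on.
theorem4 𝓡 = fromℕ 24 ⁻¹ , 0<1/24 , 16 , bounds
  where
  open RealNumbers 𝓡
  open LowerBound 𝓡

  bounds : (n : ℕ) .{{_ : NonZero n}} → 16 ℕ.≤ n →
    ((α : ℝ) → 0# < α →
      (∃ λ (p : Player 𝓡 optimumInformation n) → CompetitiveInRandomOrder 𝓡 α p) →
      fromℕ 24 ⁻¹ * log₂ n ≤ α)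
    ×
    ((α : ℝ) → 0# < α →
      (∃ λ (p : Player 𝓡 fullInformation n) → CompetitiveInArbitraryOrder 𝓡 α p) →
      fromℕ 24 ⁻¹ * log₂ n ≤ α)
  bounds n@(suc _) 16≤n with log₁₆ n (s≤s z≤n)
  ... | M , 16^M≤n , n<16^[1+M] =
    (λ α 0<α (p , competitive) → log-bound 0<α n M 1≤M n<16^[1+M]
      -- The same `M` serves both cases, as 2ᴹ ≤ 16ᴹ ≤ n.
      (random-order-bound 0<α M (ℕ.≤-trans (ℕ.^-monoˡ-≤ M (s≤s (s≤s z≤n))) 16^M≤n) p competitive)) ,
    (λ α 0<α (p , competitive) → log-bound 0<α n M 1≤M n<16^[1+M]
      (arbitrary-order-bound 0<α M 1≤M 16^M≤n p competitive))
    where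
    1≤M = 1≤log₁₆ M 16≤n n<16^[1+M]
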